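{- Let $k\ge 3$, let $\mathcal P_k$ be the path with vertices $1,\dots,k$, and let $l\ge 3$ be an integer. There exists a Braess edge $\{i,j\}$ of $\mathcal P_k$ with $j-i+1=l$ (i.e. whose addition creates a cycle of length $l$) if and only if $k>l^2-\frac34 l+\frac{7}{16}$.
   Context: For a connected graph $G$, $\kappa(G)$ denotes Kemeny's constant of the simple random walk on $G$: $\kappa(G)=\sum_{j\neq i} m_{ij}\pi_j$, where $m_{ij}$ is the mean first passage time from $i$ to $j$ and $\pi$ is the stationary distribution; this is independent of $i$. A pair $\{u,v\}$ of nonadjacent vertices of $G$ is a Braess edge of $G$ if adding the edge $\{u,v\}$ to $G$ strictly increases $\kappa$. -}

module Defs where

open import Data.Nat as ℕ using (ℕ; zero; suc; _≡ᵇ_)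
open import Data.Fin as F using (Fin; toℕ)
open import Data.Fin.Properties using (_≟_)
open import Data.Bool using (Bool; true; false; if_then_else_; _∨_; _∧_)
open import Data.Integer using (+_)
open import Data.Rational as ℚ using (ℚ; 0ℚ; 1ℚ; _+_; _*_; _<_; _≤_)
open import Relation.Nullary.Decidable using (⌊_⌋)
open import Data.Product using (_×_; ∃; ∃₂)
open import Relation.Binary.PropositionalEquality using (_≡_; _≢_)

Adj : ℕ → Set
Adj n = Fin n → Fin n → Bool

sumℕ : (n : ℕ) → (Fin n → ℕ) → ℕ
sumℕ zero    f = 0
sumℕ (suc n) f = f F.zero ℕ.+ sumℕ n (λ i → f (F.suc i))

sumℚ : (n : ℕ) → (Fin n → ℚ) → ℚ
sumℚ zero    f = 0ℚ
sumℚ (suc n) f = f F.zero + sumℚ n (λ i → f (F.suc i))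

deg : {n : ℕ} → Adj n → Fin n → ℕ
deg {n} A i = sumℕ n (λ j → if A i j then 1 else 0)

-- transition probability of the simple random walk: p_ij = a_ij / deg i
-- (set to 0 for an isolated vertex; never happens in a connected graph, n ≥ 2)
trans : {n : ℕ} → Adj n → Fin n → Fin n → ℚ
trans A i j with deg A i
... | zero  = 0ℚ
... | suc d = (if A i j then + 1 else + 0) ℚ./ suc d

IsStationary : {n : ℕ} → Adj n → (Fin n → ℚ) → Set
IsStationary {n} A π =
  (∀ j → 0ℚ ≤ π j) × (sumℚ n π ≡ 1ℚ) ×
  (∀ j → π j ≡ sumℚ n (λ i → π i * trans A i j))

-- m i j are the mean first passage times of the simple random walk on A:
-- the (unique, for connected graphs) solution of the first-step equations
--   m_ij = 1 + Σ_{k ≠ j} p_ik m_kj .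
IsMFPT : {n : ℕ} → Adj n → (Fin n → Fin n → ℚ) → Set
IsMFPT {n} A m =
  ∀ i j → m i j ≡ 1ℚ + sumℚ n (λ k → if ⌊ k ≟ j ⌋ then 0ℚ else trans A i k * m k j)

IsKemeny : {n : ℕ} → Adj n → ℚ → Set
IsKemeny {n} A κ =
  ∃₂ λ (m : Fin n → Fin n → ℚ) (π : Fin n → ℚ) →
    IsMFPT A m × IsStationary A π ×
    (∀ i → κ ≡ sumℚ n (λ j → if ⌊ j ≟ i ⌋ then 0ℚ else m i j * π j))

addEdge : {n : ℕ} → Adj n → Fin n → Fin n → Adj n
addEdge A u v x y =
  A x y ∨ (⌊ x ≟ u ⌋ ∧ ⌊ y ≟ v ⌋) ∨ (⌊ x ≟ v ⌋ ∧ ⌊ y ≟ u ⌋)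

IsBraess : {n : ℕ} → Adj n → Fin n → Fin n → Set
IsBraess A u v =
  u ≢ v × A u v ≡ false ×
  ∃₂ λ κ κ' → IsKemeny A κ × IsKemeny (addEdge A u v) κ' × κ < κ'

-- the path P_k on vertices 0,…,k-1 (standing for 1,…,k)
pathAdj : (k : ℕ) → Adj k
pathAdj k x y = ((toℕ x ℕ.+ 1) ≡ᵇ toℕ y) ∨ ((toℕ y ℕ.+ 1) ≡ᵇ toℕ x)

ℕtoℚ : ℕ → ℚ
ℕtoℚ n = + n ℚ./ 1

{-# OPTIONS --safe #-}

-- Let L be the graph Laplacian, d the degree vector and suppose that a symmetric Γ satisfies
-- L Γ = σ I − q 1ᵀ.  Since L is self-adjoint, pairing Γ with the first-passage equations
-- L m_{·j} = d − vol δ_j determines m, and Kemeny's constant becomes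
--     σ vol κ = vol Σ_j d_j Γ_jj − Σ_{j,k} d_j d_k Γ_jk ;
-- conversely this m solves the equations.  On the path Γ_xy = −|x − y| works, with σ = 2, and
-- a Sherman–Morrison update gives Γ after a new edge.  If the edge leaves tails with a and b
-- edges outside a cycle of length l = c + 1, then with n = a + b
--     6 l (n + l) (κ′ − κ) = l (4 n² − 4 c² n − (c − 1)² l) − 12 (l + c²) a b .
-- For fixed l and n this is largest when a b = 0, and then it is positive exactly when
-- 4 n > 4 c² + c − 2, which for integers is the stated bound on k = n + l.
module Submission where

-- `IsBraess` quantifies existentially over `m`, `π` and both constants, so one direction has to
-- evaluate every possible witness and the other has to build one. A Green function does both by
-- explicit formulas. An obstacle is the diagonal: the first-step equations make `m j j` the mean
-- return time, not 0. Kac's formula μ_j m_jj = Σ μ, applied to the degrees and to `π`, fixes the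
-- diagonal and gives π = d / vol at the same stroke.
--
-- The path suits -|x - y| because its second difference is concentrated at y; the only defect q is
-- one unit at each end. A new edge changes the Laplacian by a rank-one term, hence
-- Sherman-Morrison. Scaling by σ, and by 3 for sums of squares, keeps all identities polynomial.
--
-- The stated threshold is not the real root of the quadratic in n, which is irrational in general.
-- Four times the positive root lies strictly between 4c² + c - 2 and 4c² + c - 1, and so does the
-- stated bound, which reads 4n > 4c² + c - 5/4; no integer separates the two.

open import Defs
open Defs using () renaming (ℕtoℚ to ι)

-- Rational arithmetic and the embedding `ι` of the naturals.

module Rationals where

  open import Data.Integer as ℤ using (+_; +<+)
  import Data.Integer.Properties as ℤₚ
  open import Data.Maybe using (Maybe)
  open import Data.Nat as ℕ using (ℕ; suc)
  import Data.Nat.Coprimality as C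
  open import Data.Rational
  open import Data.Rational.Properties
  open import Level using (0ℓ)
  open import Relation.Binary.PropositionalEquality hiding (trans)
  import Relation.Binary.PropositionalEquality as ≡
  open import Relation.Nullary.Decidable using (dec⇒maybe)
  open import Tactic.RingSolver.Core.AlmostCommutativeRing using (AlmostCommutativeRing; fromCommutativeRing)

  -- Lets the ring solver recognise coefficients that cancel to zero.
  isZero : ∀ p → Maybe (0ℚ ≡ p)
  isZero p = dec⇒maybe (0ℚ ≟ p)

  ring : AlmostCommutativeRing 0ℓ 0ℓ
  ring = fromCommutativeRing +-*-commutativeRing isZero

  *-cancelˡ : ∀ p .{{_ : NonZero p}} {x y} → p * x ≡ p * y → x ≡ y
  *-cancelˡ p {x} {y} eq = begin
    x                ≡⟨ unit x ⟨
    1/ p * (p * x)   ≡⟨ cong (1/ p *_) eq ⟩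
    1/ p * (p * y)   ≡⟨ unit y ⟩
    y                ∎
    where
    open ≡-Reasoning
    unit : ∀ z → 1/ p * (p * z) ≡ z
    unit z = ≡.trans (sym (*-assoc (1/ p) p z)) (≡.trans (cong (_* z) (*-inverseˡ p)) (*-identityˡ z))

  -- For a variable `n` the quotient `+ n / 1` is stuck on a gcd. Rewriting to the canonical form
  -- lets the arithmetic below compute.
  ι-mkℚ : ∀ n → ι n ≡ mkℚ (+ n) 0 (C.sym (C.1-coprimeTo n))
  ι-mkℚ n = normalize-coprime (C.sym (C.1-coprimeTo n))

  ι-+ : ∀ m n → ι (m ℕ.+ n) ≡ ι m + ι n
  ι-+ m n rewrite ι-mkℚ m | ι-mkℚ n =
    sym (cong (_/ 1) (cong₂ ℤ._+_ (ℤₚ.*-identityʳ (+ m)) (ℤₚ.*-identityʳ (+ n))))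

  ι-* : ∀ m n → ι (m ℕ.* n) ≡ ι m * ι n
  ι-* m n rewrite ι-mkℚ m | ι-mkℚ n = cong (_/ 1) (ℤₚ.pos-* m n)

  ι-mono-< : ∀ {m n} → m ℕ.< n → ι m < ι n
  ι-mono-< {m} {n} m<n rewrite ι-mkℚ m | ι-mkℚ n =
    *<* (subst₂ ℤ._<_ (sym (ℤₚ.*-identityʳ (+ m))) (sym (ℤₚ.*-identityʳ (+ n))) (+<+ m<n))

  ι-cancel-< : ∀ {m n} → ι m < ι n → m ℕ.< n
  ι-cancel-< {m} {n} m<n rewrite ι-mkℚ m | ι-mkℚ n =
    ℤₚ.drop‿+<+ (subst₂ ℤ._<_ (ℤₚ.*-identityʳ (+ m)) (ℤₚ.*-identityʳ (+ n)) (drop-*<* m<n))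

  ι-pos : ∀ n .{{_ : ℕ.NonZero n}} → Positive (ι n)
  ι-pos n = normalize-pos n 1

  ι-/ : ∀ d → ι (suc d) * (+ 1 / suc d) ≡ 1ℚ
  ι-/ d rewrite ι-mkℚ (suc d) | normalize-coprime {1} {d} (C.1-coprimeTo (suc d)) =
    *-inverseʳ (mkℚ (+ suc d) 0 (C.sym (C.1-coprimeTo (suc d))))

-- Finite sums and the Kronecker delta.

module Sums where

  open import Data.Bool using (if_then_else_)
  open import Data.Fin as F using (Fin)
  open import Data.Fin.Properties using (_≟_)
  open import Data.Nat using (zero; suc)
  open import Data.Rational hiding (_≟_; floor)
  open import Data.Rational.Properties hiding (_≟_)
  open import Relation.Binary.PropositionalEquality hiding (trans)
  import Relation.Binary.PropositionalEquality as ≡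
  open import Relation.Nullary using (yes; no; contradiction)
  open import Relation.Nullary.Decidable using (⌊_⌋)
  open import Tactic.RingSolver using (solve-∀)
  open Rationals

  sum-cong : ∀ n {f g : Fin n → ℚ} → (∀ i → f i ≡ g i) → sumℚ n f ≡ sumℚ n g
  sum-cong zero    eq = refl
  sum-cong (suc n) eq = cong₂ _+_ (eq F.zero) (sum-cong n (λ i → eq (F.suc i)))

  sum-0 : ∀ n → sumℚ n (λ _ → 0ℚ) ≡ 0ℚ
  sum-0 zero    = refl
  sum-0 (suc n) = ≡.trans (+-identityˡ _) (sum-0 n)

  sum-+ : ∀ n (f g : Fin n → ℚ) → sumℚ n (λ i → f i + g i) ≡ sumℚ n f + sumℚ n g
  sum-+ zero    f g = refl
  sum-+ (suc n) f g = ≡.trans (cong (f F.zero + g F.zero +_) (sum-+ n (λ i → f (F.suc i)) (λ i → g (F.suc i))))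
    (interchange (f F.zero) (g F.zero) (sumℚ n (λ i → f (F.suc i))) (sumℚ n (λ i → g (F.suc i))))
    where
    interchange : ∀ a b c d → a + b + (c + d) ≡ a + c + (b + d)
    interchange = solve-∀ ring

  sum-*ˡ : ∀ n c (f : Fin n → ℚ) → sumℚ n (λ i → c * f i) ≡ c * sumℚ n f
  sum-*ˡ zero    c f = sym (*-zeroʳ c)
  sum-*ˡ (suc n) c f = ≡.trans (cong (c * f F.zero +_) (sum-*ˡ n c (λ i → f (F.suc i))))
    (sym (*-distribˡ-+ c (f F.zero) (sumℚ n (λ i → f (F.suc i)))))

  sum-*ʳ : ∀ n c (f : Fin n → ℚ) → sumℚ n (λ i → f i * c) ≡ sumℚ n f * c
  sum-*ʳ n c f = ≡.trans (sum-cong n (λ i → *-comm (f i) c)) (≡.trans (sum-*ˡ n c f) (*-comm c (sumℚ n f)))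

  sum-- : ∀ n (f g : Fin n → ℚ) → sumℚ n (λ i → f i - g i) ≡ sumℚ n f - sumℚ n g
  sum-- n f g = begin
    sumℚ n (λ i → f i - g i)                  ≡⟨ sum-cong n (λ i → minus (f i) (g i)) ⟩
    sumℚ n (λ i → f i + - 1ℚ * g i)           ≡⟨ sum-+ n f (λ i → - 1ℚ * g i) ⟩
    sumℚ n f + sumℚ n (λ i → - 1ℚ * g i)      ≡⟨ cong (sumℚ n f +_) (sum-*ˡ n (- 1ℚ) g) ⟩
    sumℚ n f + - 1ℚ * sumℚ n g                ≡⟨ minus (sumℚ n f) (sumℚ n g) ⟨
    sumℚ n f - sumℚ n g                       ∎
    where
    open ≡-Reasoning
    minus : ∀ x y → x - y ≡ x + - 1ℚ * y
    minus = solve-∀ ring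

  sum-swap : ∀ m n (f : Fin m → Fin n → ℚ) →
    sumℚ m (λ i → sumℚ n (f i)) ≡ sumℚ n (λ j → sumℚ m (λ i → f i j))
  sum-swap zero    n f = sym (sum-0 n)
  sum-swap (suc m) n f =
    ≡.trans (cong (sumℚ n (f F.zero) +_) (sum-swap m n (λ i → f (F.suc i))))
    (sym (sum-+ n (f F.zero) (λ j → sumℚ m (λ i → f (F.suc i) j))))

  δ : ∀ {n} → Fin n → Fin n → ℚ
  δ i j = if ⌊ i ≟ j ⌋ then 1ℚ else 0ℚ

  δ-suc : ∀ {n} (i j : Fin n) → δ (F.suc i) (F.suc j) ≡ δ i j
  δ-suc i j with i ≟ j
  ... | yes _ = refl
  ... | no  _ = refl

  δ-sym : ∀ {n} (i j : Fin n) → δ i j ≡ δ j i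
  δ-sym i j with i ≟ j | j ≟ i
  ... | yes _    | yes _   = refl
  ... | yes refl | no  j≢i = contradiction refl j≢i
  ... | no  i≢j  | yes refl = contradiction refl i≢j
  ... | no  _    | no  _   = refl

  sum-δ : ∀ {n} (j : Fin n) (f : Fin n → ℚ) → sumℚ n (λ i → δ i j * f i) ≡ f j
  sum-δ {suc n} F.zero    f = begin
    1ℚ * f F.zero + sumℚ n (λ i → 0ℚ * f (F.suc i))
      ≡⟨ cong₂ _+_ (*-identityˡ (f F.zero))
           (≡.trans (sum-*ˡ n 0ℚ (λ i → f (F.suc i))) (*-zeroˡ (sumℚ n (λ i → f (F.suc i))))) ⟩
    f F.zero + 0ℚ
      ≡⟨ +-identityʳ (f F.zero) ⟩
    f F.zero ∎
    where open ≡-Reasoning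
  sum-δ {suc n} (F.suc j) f = begin
    0ℚ * f F.zero + sumℚ n (λ i → δ (F.suc i) (F.suc j) * f (F.suc i))
      ≡⟨ cong₂ _+_ (*-zeroˡ (f F.zero)) (sum-cong n (λ i → cong (_* f (F.suc i)) (δ-suc i j))) ⟩
    0ℚ + sumℚ n (λ i → δ i j * f (F.suc i))
      ≡⟨ +-identityˡ _ ⟩
    sumℚ n (λ i → δ i j * f (F.suc i))
      ≡⟨ sum-δ j (λ i → f (F.suc i)) ⟩
    f (F.suc j) ∎
    where open ≡-Reasoning

  -- Turns a value at a variable vertex into a value at a fixed one, such as an end of the new edge.
  δ-transport : ∀ {n} (x y : Fin n) (f : Fin n → ℚ) → δ x y * f x ≡ δ x y * f y
  δ-transport x y f with x ≟ y
  ... | yes refl = refl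
  ... | no  _    = ≡.trans (*-zeroˡ (f x)) (sym (*-zeroˡ (f y)))

-- Kemeny's constant from a Green function of the Laplacian.

module Kemeny where

  open import Data.Bool using (Bool; true; false; if_then_else_)
  open import Data.Fin as F using (Fin)
  open import Data.Fin.Properties using (_≟_)
  open import Data.Nat as ℕ using (ℕ; zero; suc; s≤s; z≤n)
  import Data.Nat.Properties as ℕₚ
  open import Data.Product using (∃; _,_)
  open import Data.Rational hiding (_≟_; floor)
  open import Data.Rational.Properties hiding (_≟_)
  open import Relation.Binary.PropositionalEquality hiding (trans)
  import Relation.Binary.PropositionalEquality as ≡
  open import Relation.Nullary using (yes; no; contradiction)
  open import Relation.Nullary.Decidable using (⌊_⌋)
  open import Tactic.RingSolver using (solve-∀)
  open Rationals
  open Sums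
  open ≡-Reasoning

  weight : ∀ {n} → Adj n → Fin n → Fin n → ℚ
  weight A i j = if A i j then 1ℚ else 0ℚ

  degree : ∀ {n} → Adj n → Fin n → ℚ
  degree {n} A i = sumℚ n (weight A i)

  Symmetric : ∀ {n} → Adj n → Set
  Symmetric A = ∀ i j → A i j ≡ A j i

  NoIsolated : ∀ {n} → Adj n → Set
  NoIsolated A = ∀ i → ∃ λ j → A i j ≡ true

  laplacian : ∀ {n} → Adj n → (Fin n → ℚ) → Fin n → ℚ
  laplacian {n} A f x = degree A x * f x - sumℚ n (λ z → weight A x z * f z)

  ι-sum : ∀ n (b : Fin n → Bool) →
    ι (sumℕ n (λ i → if b i then 1 else 0)) ≡ sumℚ n (λ i → if b i then 1ℚ else 0ℚ)
  ι-sum zero    b = refl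
  ι-sum (suc n) b with b F.zero
  ... | true  = ≡.trans (ι-+ 1 (sumℕ n (λ i → if b (F.suc i) then 1 else 0))) (cong (1ℚ +_) (ι-sum n (λ i → b (F.suc i))))
  ... | false = ≡.trans (ι-sum n (λ i → b (F.suc i))) (sym (+-identityˡ _))

  degree≡deg : ∀ {n} (A : Adj n) i → degree A i ≡ ι (deg A i)
  degree≡deg {n} A i = sym (ι-sum n (A i))

  sumℕ-pos : ∀ n (b : Fin n → Bool) j → b j ≡ true → 0 ℕ.< sumℕ n (λ i → if b i then 1 else 0)
  sumℕ-pos (suc n) b F.zero    bj rewrite bj = s≤s z≤n
  sumℕ-pos (suc n) b (F.suc j) bj = ℕₚ.<-≤-trans (sumℕ-pos n (λ i → b (F.suc i)) j bj) (ℕₚ.m≤n+m _ _)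

  deg-pos : ∀ {n} {A : Adj n} → NoIsolated A → ∀ i → 0 ℕ.< deg A i
  deg-pos {n} {A} nbr i with j , Aij ← nbr i = sumℕ-pos n (A i) j Aij

  degree-pos : ∀ {n} {A : Adj n} → NoIsolated A → ∀ i → Positive (degree A i)
  degree-pos {A = A} nbr i =
    subst Positive (sym (degree≡deg A i)) (ι-pos (deg A i) {{ℕ.>-nonZero (deg-pos nbr i)}})

  -- Clears the denominators of the walk. Together with the symmetry of `A` this is detailed
  -- balance.
  degree*trans : ∀ {n} {A : Adj n} → NoIsolated A → ∀ i j → degree A i * trans A i j ≡ weight A i j
  degree*trans {A = A} nbr i j rewrite degree≡deg A i with deg A i | deg-pos nbr i
  ... | suc d | _ with A i j
  ...   | true  = ι-/ d
  ...   | false = ≡.trans (cong (ι (suc d) *_) (0/n≡0 (suc d))) (*-zeroʳ (ι (suc d)))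

  weight-sym : ∀ {n} {A : Adj n} → Symmetric A → ∀ i j → weight A i j ≡ weight A j i
  weight-sym A-sym i j = cong (if_then 1ℚ else 0ℚ) (A-sym i j)

  -- The degree part is visibly symmetric in `f` and `g`; in the double sum over adjacent pairs the
  -- summation variables are exchanged, which the symmetry of `A` allows.
  laplacian-selfAdjoint : ∀ {n} {A : Adj n} → Symmetric A → ∀ f g →
    sumℚ n (λ x → g x * laplacian A f x) ≡ sumℚ n (λ x → f x * laplacian A g x)
  laplacian-selfAdjoint {n} {A} A-sym f g = begin
    sumℚ n (λ x → g x * laplacian A f x)
      ≡⟨ expand f g ⟩
    sumℚ n (λ x → degree A x * f x * g x) - sumℚ n (λ x → sumℚ n (λ z → weight A x z * f z * g x))
      ≡⟨ cong₂ _-_ (sum-cong n (λ x → swapʳ (degree A x) (f x) (g x))) transpose ⟩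
    sumℚ n (λ x → degree A x * g x * f x) - sumℚ n (λ x → sumℚ n (λ z → weight A x z * g z * f x))
      ≡⟨ expand g f ⟨
    sumℚ n (λ x → f x * laplacian A g x) ∎
    where
    swapʳ : ∀ a b c → a * b * c ≡ a * c * b
    swapʳ = solve-∀ ring

    distribute : ∀ a b c d → a * (b * c - d) ≡ b * c * a - d * a
    distribute = solve-∀ ring

    expand : ∀ f g → sumℚ n (λ x → g x * laplacian A f x) ≡
      sumℚ n (λ x → degree A x * f x * g x) - sumℚ n (λ x → sumℚ n (λ z → weight A x z * f z * g x))
    expand f g = begin
      sumℚ n (λ x → g x * laplacian A f x)
        ≡⟨ sum-cong n (λ x → distribute (g x) (degree A x) (f x) (sumℚ n (λ z → weight A x z * f z))) ⟩
      sumℚ n (λ x → degree A x * f x * g x - sumℚ n (λ z → weight A x z * f z) * g x)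
        ≡⟨ sum-- n (λ x → degree A x * f x * g x) (λ x → sumℚ n (λ z → weight A x z * f z) * g x) ⟩
      sumℚ n (λ x → degree A x * f x * g x) - sumℚ n (λ x → sumℚ n (λ z → weight A x z * f z) * g x)
        ≡⟨ cong (λ t → sumℚ n (λ x → degree A x * f x * g x) - t)
             (sum-cong n (λ x → sym (sum-*ʳ n (g x) (λ z → weight A x z * f z)))) ⟩
      sumℚ n (λ x → degree A x * f x * g x) - sumℚ n (λ x → sumℚ n (λ z → weight A x z * f z * g x)) ∎

    transpose : sumℚ n (λ x → sumℚ n (λ z → weight A x z * f z * g x)) ≡
      sumℚ n (λ x → sumℚ n (λ z → weight A x z * g z * f x))
    transpose = ≡.trans (sum-swap n n (λ x z → weight A x z * f z * g x)) (sum-cong n (λ z → sum-cong n (λ x →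
      ≡.trans (swapʳ (weight A x z) (f z) (g x)) (cong (λ w → w * g x * f z) (weight-sym A-sym x z)))))

  -- Hitting times proper: the time from j to j counts as 0, whereas `m j j` in the first-step
  -- equations is a return time.
  offDiagonal : ∀ {n} → (Fin n → Fin n → ℚ) → Fin n → Fin n → ℚ
  offDiagonal m i j = if ⌊ i ≟ j ⌋ then 0ℚ else m i j

  offDiagonal-diag : ∀ {n} (m : Fin n → Fin n → ℚ) j → offDiagonal m j j ≡ 0ℚ
  offDiagonal-diag m j with j ≟ j
  ... | yes _   = refl
  ... | no  j≢j = contradiction refl j≢j

  offDiagonal-split : ∀ {n} (m : Fin n → Fin n → ℚ) i j → m i j ≡ offDiagonal m i j + δ i j * m j j
  offDiagonal-split m i j with i ≟ j
  ... | yes refl = lemma (m j j)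
    where
    lemma : ∀ x → x ≡ 0ℚ + 1ℚ * x
    lemma = solve-∀ ring
  ... | no  _    = lemma (m i j) (m j j)
    where
    lemma : ∀ x y → x ≡ x + 0ℚ * y
    lemma = solve-∀ ring

  offDiagonal-kemeny : ∀ {n} (m : Fin n → Fin n → ℚ) (π : Fin n → ℚ) i j →
    (if ⌊ j ≟ i ⌋ then 0ℚ else m i j * π j) ≡ offDiagonal m i j * π j
  offDiagonal-kemeny m π i j with j ≟ i | i ≟ j
  ... | yes _    | yes _    = sym (*-zeroˡ (π j))
  ... | yes refl | no  i≢j  = contradiction refl i≢j
  ... | no  j≢i  | yes refl = contradiction refl j≢i
  ... | no  _    | no  _    = refl

  offDiagonal-mfpt : ∀ {n} (A : Adj n) (m : Fin n → Fin n → ℚ) i j →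
    1ℚ + sumℚ n (λ k → if ⌊ k ≟ j ⌋ then 0ℚ else trans A i k * m k j) ≡
    1ℚ + sumℚ n (λ k → trans A i k * offDiagonal m k j)
  offDiagonal-mfpt {n} A m i j = cong (1ℚ +_) (sum-cong n pointwise)
    where
    pointwise : ∀ k → (if ⌊ k ≟ j ⌋ then 0ℚ else trans A i k * m k j) ≡ trans A i k * offDiagonal m k j
    pointwise k with k ≟ j
    ... | yes _ = sym (*-zeroʳ (trans A i k))
    ... | no  _ = refl

  -- Kac's formula, for an invariant weight of any total mass. Summing the first-step equations
  -- against `μ`, invariance turns the sum on the right into the same off-diagonal sum `R` that
  -- stands on the left, and only the diagonal term survives.
  invariant-return : ∀ {n} {A : Adj n} {m} {μ : Fin n → ℚ} → IsMFPT A m →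
    (∀ k → μ k ≡ sumℚ n (λ i → μ i * trans A i k)) → ∀ j → μ j * m j j ≡ sumℚ n μ
  invariant-return {n} {A} {m} {μ} mfpt inv j = cancel (μ j * m j j) (sumℚ n μ) R (begin
    μ j * m j j + R
      ≡⟨ cong (_+ R) (sum-δ j (λ i → μ i * m j j)) ⟨
    sumℚ n (λ i → δ i j * (μ i * m j j)) + R
      ≡⟨ sum-+ n (λ i → δ i j * (μ i * m j j)) (λ i → μ i * offDiagonal m i j) ⟨
    sumℚ n (λ i → δ i j * (μ i * m j j) + μ i * offDiagonal m i j)
      ≡⟨ sum-cong n (λ i → collect (δ i j) (μ i) (m j j) (offDiagonal m i j)) ⟩
    sumℚ n (λ i → μ i * (offDiagonal m i j + δ i j * m j j))
      ≡⟨ sum-cong n (λ i → cong (μ i *_) (≡.trans (sym (offDiagonal-split m i j))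
           (≡.trans (mfpt i j) (offDiagonal-mfpt A m i j)))) ⟩
    sumℚ n (λ i → μ i * (1ℚ + sumℚ n (λ k → trans A i k * offDiagonal m k j)))
      ≡⟨ sum-cong n (λ i → ≡.trans (distribute (μ i) (sumℚ n (λ k → trans A i k * offDiagonal m k j)))
           (cong (μ i +_) (sym (sum-*ˡ n (μ i) (λ k → trans A i k * offDiagonal m k j))))) ⟩
    sumℚ n (λ i → μ i + sumℚ n (λ k → μ i * (trans A i k * offDiagonal m k j)))
      ≡⟨ sum-+ n μ (λ i → sumℚ n (λ k → μ i * (trans A i k * offDiagonal m k j))) ⟩
    sumℚ n μ + sumℚ n (λ i → sumℚ n (λ k → μ i * (trans A i k * offDiagonal m k j)))
      ≡⟨ cong (sumℚ n μ +_) (sum-swap n n (λ i k → μ i * (trans A i k * offDiagonal m k j))) ⟩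
    sumℚ n μ + sumℚ n (λ k → sumℚ n (λ i → μ i * (trans A i k * offDiagonal m k j)))
      ≡⟨ cong (sumℚ n μ +_) (sum-cong n (λ k → ≡.trans
           (sum-cong n (λ i → sym (*-assoc (μ i) (trans A i k) (offDiagonal m k j))))
           (sum-*ʳ n (offDiagonal m k j) (λ i → μ i * trans A i k)))) ⟩
    sumℚ n μ + sumℚ n (λ k → sumℚ n (λ i → μ i * trans A i k) * offDiagonal m k j)
      ≡⟨ cong (sumℚ n μ +_) (sum-cong n (λ k → cong (_* offDiagonal m k j) (sym (inv k)))) ⟩
    sumℚ n μ + R ∎)
    where
    R = sumℚ n (λ i → μ i * offDiagonal m i j)
    cancel : ∀ x y z → x + z ≡ y + z → x ≡ y
    cancel x y z eq = ≡.trans (sym (shift x z)) (≡.trans (cong (_- z) eq) (shift y z))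
      where
      shift : ∀ x z → x + z - z ≡ x
      shift = solve-∀ ring
    collect : ∀ e u v w → e * (u * v) + u * w ≡ u * (w + e * v)
    collect = solve-∀ ring
    distribute : ∀ u v → u * (1ℚ + v) ≡ u + u * v
    distribute = solve-∀ ring

  degree-invariant : ∀ {n} {A : Adj n} → Symmetric A → NoIsolated A →
    ∀ k → degree A k ≡ sumℚ n (λ i → degree A i * trans A i k)
  degree-invariant {n} A-sym nbr k =
    sum-cong n (λ i → ≡.trans (weight-sym A-sym k i) (sym (degree*trans nbr i k)))

  volume : ∀ {n} → Adj n → ℚ
  volume {n} A = sumℚ n (degree A)

  -- The scale σ keeps Γ integral, and q is the defect forced by the kernel of the Laplacian.
  record IsGreen {n} (A : Adj n) (σ : ℚ) (q : Fin n → ℚ) (Γ : Fin n → Fin n → ℚ) : Set where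
    field
      Γ-sym : ∀ x y → Γ x y ≡ Γ y x
      Γ-laplacian : ∀ x y → laplacian A (λ z → Γ z y) x ≡ σ * δ x y - q x

  module _ {n} {A : Adj n} {σ q Γ} (A-sym : Symmetric A) (nbr : NoIsolated A) (green : IsGreen A σ q Γ) where

    open IsGreen green

    potential : Fin n → ℚ
    potential x = sumℚ n (λ y → degree A y * Γ x y)

    -- σ times the mean hitting time. The defect `q` cancels between Γd and vol Γ_j, and the
    -- subtracted constants make the value at j vanish.
    hitting : Fin n → Fin n → ℚ
    hitting x j = potential x - potential j - volume A * (Γ x j - Γ j j)

    kemenyNumerator : ℚ
    kemenyNumerator = volume A * sumℚ n (λ j → degree A j * Γ j j) - sumℚ n (λ j → degree A j * potential j)

    -- The random target property: vol times the potential of `x` enters once with each sign, so the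
    -- start `x` drops out.
    sum-hitting : ∀ x → sumℚ n (λ j → degree A j * hitting x j) ≡ kemenyNumerator
    sum-hitting x = begin
      sumℚ n (λ j → degree A j * hitting x j)
        ≡⟨ sum-cong n (λ j → distribute (degree A j) (potential x) (potential j) (volume A) (Γ x j) (Γ j j)) ⟩
      sumℚ n (λ j → dΦ j - dφ j + (dΓ j - dΓₓ j))
        ≡⟨ ≡.trans (sum-+ n (λ j → dΦ j - dφ j) (λ j → dΓ j - dΓₓ j))
             (cong₂ _+_ (sum-- n dΦ dφ) (sum-- n dΓ dΓₓ)) ⟩
      sumℚ n dΦ - sumℚ n dφ + (sumℚ n dΓ - sumℚ n dΓₓ)
        ≡⟨ cong₂ (λ a b → a - sumℚ n dφ + b)
             (sum-*ʳ n (potential x) (degree A))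
             (cong₂ _-_ (sum-*ˡ n (volume A) (λ j → degree A j * Γ j j))
                        (sum-*ˡ n (volume A) (λ j → degree A j * Γ x j))) ⟩
      volume A * potential x - sumℚ n dφ
      + (volume A * sumℚ n (λ j → degree A j * Γ j j) - volume A * potential x)
        ≡⟨ collect (volume A * potential x) (sumℚ n dφ) (volume A * sumℚ n (λ j → degree A j * Γ j j)) ⟩
      kemenyNumerator ∎
      where
      dΦ dφ dΓ dΓₓ : Fin n → ℚ
      dΦ j = degree A j * potential x
      dφ j = degree A j * potential j
      dΓ j = volume A * (degree A j * Γ j j)
      dΓₓ j = volume A * (degree A j * Γ x j)
      distribute : ∀ d p r v g h → d * (p - r - v * (g - h)) ≡ d * p - d * r + (v * (d * h) - v * (d * g))
      distribute = solve-∀ ring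
      collect : ∀ a b c → a - b + (c - a) ≡ c - b
      collect = solve-∀ ring

    -- Valid for whichever `m` and `π` witness `κ`: both are identified inside the proof, `π` by
    -- `volume*π` and the off-diagonal part of `m` by `σ*offDiagonal`. The vertex `o` is the start
    -- at which the sum is evaluated.
    kemeny-unique : Fin n → ∀ {κ} → IsKemeny A κ → σ * volume A * κ ≡ kemenyNumerator
    kemeny-unique o {κ} (m , π , mfpt , (_ , π-sum , π-inv) , kemeny) = begin
      σ * volume A * κ
        ≡⟨ cong (σ * volume A *_) (≡.trans (kemeny o) (sum-cong n (offDiagonal-kemeny m π o))) ⟩
      σ * volume A * sumℚ n (λ j → offDiagonal m o j * π j)
        ≡⟨ sum-*ˡ n (σ * volume A) (λ j → offDiagonal m o j * π j) ⟨
      sumℚ n (λ j → σ * volume A * (offDiagonal m o j * π j))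
        ≡⟨ sum-cong n (λ j → ≡.trans (regroup σ (volume A) (offDiagonal m o j) (π j))
             (cong₂ _*_ (volume*π j) (σ*offDiagonal o j))) ⟩
      sumℚ n (λ j → degree A j * hitting o j)
        ≡⟨ sum-hitting o ⟩
      kemenyNumerator ∎
      where
      regroup : ∀ s v a b → s * v * (a * b) ≡ v * b * (s * a)
      regroup = solve-∀ ring

      degree*return : ∀ j → degree A j * m j j ≡ volume A
      degree*return = invariant-return {A = A} mfpt (degree-invariant A-sym nbr)

      -- Kac's formula for two invariant weights: d_j m_jj = vol and π_j m_jj = 1. Eliminating m_jj
      -- leaves the claim.
      volume*π : ∀ j → volume A * π j ≡ degree A j
      volume*π j = begin
        volume A * π j                    ≡⟨ cong (_* π j) (degree*return j) ⟨
        degree A j * m j j * π j          ≡⟨ lemma (degree A j) (m j j) (π j) ⟩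
        degree A j * (π j * m j j)        ≡⟨ cong (degree A j *_) (≡.trans (invariant-return {A = A} mfpt π-inv j) π-sum) ⟩
        degree A j * 1ℚ                   ≡⟨ *-identityʳ _ ⟩
        degree A j                        ∎
        where
        lemma : ∀ a b c → a * b * c ≡ a * (c * b)
        lemma = solve-∀ ring

      -- The first-step equation multiplied by the degree. The return time enters only for i = j,
      -- where degree times return time is the volume.
      laplacian-offDiagonal : ∀ i j → laplacian A (λ k → offDiagonal m k j) i ≡ degree A i - δ i j * volume A
      laplacian-offDiagonal i j = begin
        degree A i * offDiagonal m i j - sumℚ n (λ k → weight A i k * offDiagonal m k j)
          ≡⟨ cong (λ t → degree A i * offDiagonal m i j - t) (sum-cong n (λ k → ≡.trans
               (cong (_* offDiagonal m k j) (sym (degree*trans nbr i k)))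
               (*-assoc (degree A i) (trans A i k) (offDiagonal m k j)))) ⟩
        degree A i * offDiagonal m i j - sumℚ n (λ k → degree A i * (trans A i k * offDiagonal m k j))
          ≡⟨ cong (λ t → degree A i * offDiagonal m i j - t) (sum-*ˡ n (degree A i) (λ k → trans A i k * offDiagonal m k j)) ⟩
        degree A i * offDiagonal m i j - degree A i * P
          ≡⟨ lemma (degree A i) (offDiagonal m i j) P (δ i j * m j j) ⟩
        degree A i * (offDiagonal m i j + δ i j * m j j) - degree A i * (1ℚ + P) + degree A i - degree A i * (δ i j * m j j)
          ≡⟨ cong (λ t → degree A i * t - degree A i * (1ℚ + P) + degree A i - degree A i * (δ i j * m j j))
               (≡.trans (sym (offDiagonal-split m i j)) (≡.trans (mfpt i j) (offDiagonal-mfpt A m i j))) ⟩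
        degree A i * (1ℚ + P) - degree A i * (1ℚ + P) + degree A i - degree A i * (δ i j * m j j)
          ≡⟨ lemma₂ (degree A i * (1ℚ + P)) (degree A i) (degree A i * (δ i j * m j j)) ⟩
        degree A i - degree A i * (δ i j * m j j)
          ≡⟨ cong (λ t → degree A i - t) (localise i j) ⟩
        degree A i - δ i j * volume A ∎
        where
        P = sumℚ n (λ k → trans A i k * offDiagonal m k j)
        lemma : ∀ d o p e → d * o - d * p ≡ d * (o + e) - d * (1ℚ + p) + d - d * e
        lemma = solve-∀ ring
        lemma₂ : ∀ a b c → a - a + b - c ≡ b - c
        lemma₂ = solve-∀ ring
        localise : ∀ i j → degree A i * (δ i j * m j j) ≡ δ i j * volume A
        localise i j with i ≟ j
        ... | yes refl = ≡.trans (unit (degree A j) (m j j)) (≡.trans (degree*return j) (sym (*-identityˡ _)))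
          where
          unit : ∀ a b → a * (1ℚ * b) ≡ a * b
          unit = solve-∀ ring
        ... | no _ = zeros (degree A i) (m j j) (volume A)
          where
          zeros : ∀ a b c → a * (0ℚ * b) ≡ 0ℚ * c
          zeros = solve-∀ ring

      -- Pairing the columns of Γ and of m through the self-adjoint Laplacian
      -- determines each column of m up to an additive constant.
      pairing : ∀ x j → σ * offDiagonal m x j - sumℚ n (λ i → offDiagonal m i j * q i) ≡
                        potential x - volume A * Γ x j
      pairing x j = begin
        σ * offDiagonal m x j - sumℚ n (λ i → offDiagonal m i j * q i)
          ≡⟨ cong (_- sumℚ n (λ i → offDiagonal m i j * q i)) (sum-δ x (λ i → σ * offDiagonal m i j)) ⟨
        sumℚ n (λ i → δ i x * (σ * offDiagonal m i j)) - sumℚ n (λ i → offDiagonal m i j * q i)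
          ≡⟨ sum-- n (λ i → δ i x * (σ * offDiagonal m i j)) (λ i → offDiagonal m i j * q i) ⟨
        sumℚ n (λ i → δ i x * (σ * offDiagonal m i j) - offDiagonal m i j * q i)
          ≡⟨ sum-cong n (λ i → ≡.trans (factor (δ i x) σ (offDiagonal m i j) (q i))
               (cong (offDiagonal m i j *_) (sym (Γ-laplacian i x)))) ⟩
        sumℚ n (λ i → offDiagonal m i j * laplacian A (λ z → Γ z x) i)
          ≡⟨ laplacian-selfAdjoint A-sym (λ z → Γ z x) (λ i → offDiagonal m i j) ⟩
        sumℚ n (λ i → Γ i x * laplacian A (λ k → offDiagonal m k j) i)
          ≡⟨ sum-cong n (λ i → cong₂ _*_ (Γ-sym i x) (laplacian-offDiagonal i j)) ⟩
        sumℚ n (λ i → Γ x i * (degree A i - δ i j * volume A))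
          ≡⟨ sum-cong n (λ i → expand (Γ x i) (degree A i) (δ i j) (volume A)) ⟩
        sumℚ n (λ i → degree A i * Γ x i - δ i j * (volume A * Γ x i))
          ≡⟨ sum-- n (λ i → degree A i * Γ x i) (λ i → δ i j * (volume A * Γ x i)) ⟩
        potential x - sumℚ n (λ i → δ i j * (volume A * Γ x i))
          ≡⟨ cong (λ t → potential x - t) (sum-δ j (λ i → volume A * Γ x i)) ⟩
        potential x - volume A * Γ x j ∎
        where
        factor : ∀ e s o q → e * (s * o) - o * q ≡ o * (s * e - q)
        factor = solve-∀ ring
        expand : ∀ g d e v → g * (d - e * v) ≡ d * g - e * (v * g)
        expand = solve-∀ ring

      σ*offDiagonal : ∀ x j → σ * offDiagonal m x j ≡ hitting x j
      σ*offDiagonal x j = begin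
        σ * offDiagonal m x j
          -- Subtracting the instance x = j, where the hitting time is 0, removes the unknown
          -- constant `C` of the column.
          ≡⟨ lemma₁ (σ * offDiagonal m x j) C σ ⟩
        (σ * offDiagonal m x j - C) - (σ * 0ℚ - C)
          ≡⟨ cong (λ t → (σ * offDiagonal m x j - C) - (σ * t - C)) (offDiagonal-diag m j) ⟨
        (σ * offDiagonal m x j - C) - (σ * offDiagonal m j j - C)
          ≡⟨ cong₂ _-_ (pairing x j) (pairing j j) ⟩
        (potential x - volume A * Γ x j) - (potential j - volume A * Γ j j)
          ≡⟨ lemma₂ (potential x) (potential j) (volume A) (Γ x j) (Γ j j) ⟩
        hitting x j ∎
        where
        C = sumℚ n (λ i → offDiagonal m i j * q i)
        lemma₁ : ∀ a c s → a ≡ (a - c) - (s * 0ℚ - c)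
        lemma₁ = solve-∀ ring
        lemma₂ : ∀ a b v g h → (a - v * g) - (b - v * h) ≡ a - b - v * (g - h)
        lemma₂ = solve-∀ ring

    laplacian-potential : ∀ i → laplacian A potential i ≡ σ * degree A i - volume A * q i
    laplacian-potential i = begin
      degree A i * potential i - sumℚ n (λ z → weight A i z * potential z)
        ≡⟨ cong₂ _-_ (sym (sum-*ˡ n (degree A i) (λ y → degree A y * Γ i y))) (≡.trans
             (sum-cong n (λ z → sym (sum-*ˡ n (weight A i z) (λ y → degree A y * Γ z y))))
             (sum-swap n n (λ z y → weight A i z * (degree A y * Γ z y)))) ⟩
      sumℚ n (λ y → degree A i * (degree A y * Γ i y)) - sumℚ n (λ y → sumℚ n (λ z → weight A i z * (degree A y * Γ z y)))
        ≡⟨ sum-- n (λ y → degree A i * (degree A y * Γ i y)) (λ y → sumℚ n (λ z → weight A i z * (degree A y * Γ z y))) ⟨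
      sumℚ n (λ y → degree A i * (degree A y * Γ i y) - sumℚ n (λ z → weight A i z * (degree A y * Γ z y)))
        ≡⟨ sum-cong n column ⟩
      sumℚ n (λ y → δ y i * (σ * degree A y) - degree A y * q i)
        ≡⟨ sum-- n (λ y → δ y i * (σ * degree A y)) (λ y → degree A y * q i) ⟩
      sumℚ n (λ y → δ y i * (σ * degree A y)) - sumℚ n (λ y → degree A y * q i)
        ≡⟨ cong₂ _-_ (sum-δ i (λ y → σ * degree A y)) (sum-*ʳ n (q i) (degree A)) ⟩
      σ * degree A i - volume A * q i ∎
      where
      swapˡ : ∀ a b c → a * (b * c) ≡ b * (a * c)
      swapˡ = solve-∀ ring
      factor : ∀ a b c s → a * (b * c) - b * s ≡ b * (a * c - s)
      factor = solve-∀ ring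
      expand : ∀ d s e q → d * (s * e - q) ≡ e * (s * d) - d * q
      expand = solve-∀ ring
      column : ∀ y → degree A i * (degree A y * Γ i y) - sumℚ n (λ z → weight A i z * (degree A y * Γ z y)) ≡
                     δ y i * (σ * degree A y) - degree A y * q i
      column y = begin
        degree A i * (degree A y * Γ i y) - sumℚ n (λ z → weight A i z * (degree A y * Γ z y))
          ≡⟨ cong (λ t → degree A i * (degree A y * Γ i y) - t) (≡.trans
               (sum-cong n (λ z → swapˡ (weight A i z) (degree A y) (Γ z y)))
               (sum-*ˡ n (degree A y) (λ z → weight A i z * Γ z y))) ⟩
        degree A i * (degree A y * Γ i y) - degree A y * sumℚ n (λ z → weight A i z * Γ z y)
          ≡⟨ factor (degree A i) (degree A y) (Γ i y) (sumℚ n (λ z → weight A i z * Γ z y)) ⟩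
        degree A y * laplacian A (λ z → Γ z y) i
          ≡⟨ cong (degree A y *_) (Γ-laplacian i y) ⟩
        degree A y * (σ * δ i y - q i)
          ≡⟨ expand (degree A y) σ (δ i y) (q i) ⟩
        δ i y * (σ * degree A y) - degree A y * q i
          ≡⟨ cong (λ e → e * (σ * degree A y) - degree A y * q i) (δ-sym i y) ⟩
        δ y i * (σ * degree A y) - degree A y * q i ∎

    -- The potential contributes -vol q and the column of Γ contributes +vol q; constants lie in the
    -- kernel. What remains is the equation that determines hitting times.
    laplacian-hitting : ∀ i j → laplacian A (λ x → hitting x j) i ≡ σ * (degree A i - δ i j * volume A)
    laplacian-hitting i j = begin
      degree A i * hitting i j - sumℚ n (λ z → weight A i z * hitting z j)
        ≡⟨ cong (λ t → degree A i * hitting i j - t) neighbours ⟩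
      degree A i * hitting i j - (Φ - V * Ψ + degree A i * (V * Γ j j - potential j))
        ≡⟨ regroup (degree A i) (potential i) (potential j) V (Γ i j) (Γ j j) Φ Ψ ⟩
      laplacian A potential i - V * laplacian A (λ z → Γ z j) i
        ≡⟨ cong₂ (λ a b → a - V * b) (laplacian-potential i) (Γ-laplacian i j) ⟩
      σ * degree A i - V * q i - V * (σ * δ i j - q i)
        ≡⟨ collect σ (degree A i) V (q i) (δ i j) ⟩
      σ * (degree A i - δ i j * V) ∎
      where
      V = volume A
      Φ = sumℚ n (λ z → weight A i z * potential z)
      Ψ = sumℚ n (λ z → weight A i z * Γ z j)
      expand : ∀ w p r v g h → w * (p - r - v * (g - h)) ≡ w * p - v * (w * g) + w * (v * h - r)
      expand = solve-∀ ring
      regroup : ∀ d p r v g h a b →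
        d * (p - r - v * (g - h)) - (a - v * b + d * (v * h - r)) ≡ (d * p - a) - v * (d * g - b)
      regroup = solve-∀ ring
      collect : ∀ s d v q e → s * d - v * q - v * (s * e - q) ≡ s * (d - e * v)
      collect = solve-∀ ring
      neighbours : sumℚ n (λ z → weight A i z * hitting z j) ≡ Φ - V * Ψ + degree A i * (V * Γ j j - potential j)
      neighbours = begin
        sumℚ n (λ z → weight A i z * hitting z j)
          ≡⟨ sum-cong n (λ z → expand (weight A i z) (potential z) (potential j) V (Γ z j) (Γ j j)) ⟩
        sumℚ n (λ z → weight A i z * potential z - V * (weight A i z * Γ z j) + weight A i z * (V * Γ j j - potential j))
          ≡⟨ sum-+ n (λ z → weight A i z * potential z - V * (weight A i z * Γ z j))
                     (λ z → weight A i z * (V * Γ j j - potential j)) ⟩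
        sumℚ n (λ z → weight A i z * potential z - V * (weight A i z * Γ z j))
        + sumℚ n (λ z → weight A i z * (V * Γ j j - potential j))
          ≡⟨ cong₂ _+_
               (≡.trans (sum-- n (λ z → weight A i z * potential z) (λ z → V * (weight A i z * Γ z j)))
                        (cong (λ t → Φ - t) (sum-*ˡ n V (λ z → weight A i z * Γ z j))))
               (sum-*ʳ n (V * Γ j j - potential j) (weight A i)) ⟩
        Φ - V * Ψ + degree A i * (V * Γ j j - potential j) ∎

    kemeny-exists : .{{_ : NonZero σ}} .{{_ : Positive (volume A)}} → ∃ (IsKemeny A)
    kemeny-exists = r * v * kemenyNumerator , m , π , mfpt , (π-nonNeg , π-sum , π-inv) , kemeny
      where
      instance
        V≢0 : NonZero (volume A)
        V≢0 = pos⇒nonZero (volume A)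

        V⁻¹>0 : Positive (1/ volume A)
        V⁻¹>0 = 1/pos⇒pos (volume A)

        d>0 : ∀ {i} → Positive (degree A i)
        d>0 {i} = degree-pos nbr i

        d≢0 : ∀ {i} → NonZero (degree A i)
        d≢0 {i} = pos⇒nonZero (degree A i)

      r = 1/ σ
      v = 1/ volume A

      π : Fin n → ℚ
      π j = v * degree A j

      -- `hitting` vanishes on the diagonal, so the return time vol / d_j demanded by Kac's formula
      -- is added there.
      m : Fin n → Fin n → ℚ
      m i j = r * hitting i j + δ i j * (volume A * 1/ degree A j)

      π-nonNeg : ∀ j → 0ℚ ≤ π j
      π-nonNeg j = <⇒≤ (positive⁻¹ (π j) {{pos*pos⇒pos v (degree A j)}})

      π-sum : sumℚ n π ≡ 1ℚ
      π-sum = ≡.trans (sum-*ˡ n v (degree A)) (*-inverseˡ (volume A))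

      π-inv : ∀ j → π j ≡ sumℚ n (λ i → π i * trans A i j)
      π-inv j = begin
        v * degree A j
          ≡⟨ cong (v *_) (degree-invariant A-sym nbr j) ⟩
        v * sumℚ n (λ i → degree A i * trans A i j)
          ≡⟨ sum-*ˡ n v (λ i → degree A i * trans A i j) ⟨
        sumℚ n (λ i → v * (degree A i * trans A i j))
          ≡⟨ sum-cong n (λ i → sym (*-assoc v (degree A i) (trans A i j))) ⟩
        sumℚ n (λ i → v * degree A i * trans A i j) ∎

      m-offDiagonal : ∀ i j → offDiagonal m i j ≡ r * hitting i j
      m-offDiagonal i j with i ≟ j
      ... | yes refl = zeros r (potential j) (volume A) (Γ j j)
        where
        zeros : ∀ r p v g → 0ℚ ≡ r * (p - p - v * (g - g))
        zeros = solve-∀ ring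
      ... | no  _    = zeros (r * hitting i j) (volume A * 1/ degree A j)
        where
        zeros : ∀ a b → a + 0ℚ * b ≡ a
        zeros = solve-∀ ring

      localise : ∀ i j → degree A i * (δ i j * (volume A * 1/ degree A j)) ≡ δ i j * volume A
      localise i j with i ≟ j
      ... | yes refl = ≡.trans (regroup (degree A j) (volume A) (1/ degree A j))
                         (cong (_* volume A) (*-inverseʳ (degree A j)))
        where
        regroup : ∀ a b c → a * (1ℚ * (b * c)) ≡ a * c * b
        regroup = solve-∀ ring
      ... | no  _    = zeros (degree A i) (volume A * 1/ degree A j) (volume A)
        where
        zeros : ∀ a b c → a * (0ℚ * b) ≡ 0ℚ * c
        zeros = solve-∀ ring

      mfpt : IsMFPT A m
      -- After multiplication by the degree the first-step equation becomes `laplacian-hitting`;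
      -- positivity of the degree permits the cancellation.
      mfpt i j = *-cancelˡ (degree A i) (begin
        degree A i * m i j
          ≡⟨ expand (degree A i) r (hitting i j) (δ i j * (volume A * 1/ degree A j)) H ⟩
        r * laplacian A (λ x → hitting x j) i + degree A i * (δ i j * (volume A * 1/ degree A j)) + r * H
          ≡⟨ cong₂ (λ a b → r * a + b + r * H) (laplacian-hitting i j) (localise i j) ⟩
        r * (σ * (degree A i - δ i j * volume A)) + δ i j * volume A + r * H
          ≡⟨ regroup r σ (degree A i) (δ i j * volume A) (r * H) ⟩
        r * σ * (degree A i - δ i j * volume A) + δ i j * volume A + r * H
          ≡⟨ cong (λ t → t * (degree A i - δ i j * volume A) + δ i j * volume A + r * H) (*-inverseˡ σ) ⟩
        1ℚ * (degree A i - δ i j * volume A) + δ i j * volume A + r * H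
          ≡⟨ collect (degree A i) (δ i j * volume A) (r * H) ⟩
        degree A i + r * H
          ≡⟨ cong (degree A i +_) neighbours ⟩
        degree A i + degree A i * sumℚ n (λ k → trans A i k * offDiagonal m k j)
          ≡⟨ factor (degree A i) (sumℚ n (λ k → trans A i k * offDiagonal m k j)) ⟩
        degree A i * (1ℚ + sumℚ n (λ k → trans A i k * offDiagonal m k j))
          ≡⟨ cong (degree A i *_) (offDiagonal-mfpt A m i j) ⟨
        degree A i * (1ℚ + sumℚ n (λ k → if ⌊ k ≟ j ⌋ then 0ℚ else trans A i k * m k j)) ∎)
        where
        H = sumℚ n (λ k → weight A i k * hitting k j)
        expand : ∀ d r h e s → d * (r * h + e) ≡ r * (d * h - s) + d * e + r * s
        expand = solve-∀ ring
        regroup : ∀ r s d e h → r * (s * (d - e)) + e + h ≡ r * s * (d - e) + e + h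
        regroup = solve-∀ ring
        collect : ∀ d e h → 1ℚ * (d - e) + e + h ≡ d + h
        collect = solve-∀ ring
        factor : ∀ d s → d + d * s ≡ d * (1ℚ + s)
        factor = solve-∀ ring
        swap : ∀ r d p h → r * (d * p * h) ≡ d * (p * (r * h))
        swap = solve-∀ ring
        neighbours : r * H ≡ degree A i * sumℚ n (λ k → trans A i k * offDiagonal m k j)
        neighbours = begin
          r * H
            ≡⟨ sum-*ˡ n r (λ k → weight A i k * hitting k j) ⟨
          sumℚ n (λ k → r * (weight A i k * hitting k j))
            ≡⟨ sum-cong n (λ k → cong (λ w → r * (w * hitting k j)) (sym (degree*trans nbr i k))) ⟩
          sumℚ n (λ k → r * (degree A i * trans A i k * hitting k j))
            ≡⟨ sum-cong n (λ k → ≡.trans (swap r (degree A i) (trans A i k) (hitting k j))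
                 (cong (λ h → degree A i * (trans A i k * h)) (sym (m-offDiagonal k j)))) ⟩
          sumℚ n (λ k → degree A i * (trans A i k * offDiagonal m k j))
            ≡⟨ sum-*ˡ n (degree A i) (λ k → trans A i k * offDiagonal m k j) ⟩
          degree A i * sumℚ n (λ k → trans A i k * offDiagonal m k j) ∎

      kemeny : ∀ i → r * v * kemenyNumerator ≡ sumℚ n (λ j → if ⌊ j ≟ i ⌋ then 0ℚ else m i j * π j)
      kemeny i = begin
        r * v * kemenyNumerator
          ≡⟨ cong (r * v *_) (sum-hitting i) ⟨
        r * v * sumℚ n (λ j → degree A j * hitting i j)
          ≡⟨ sum-*ˡ n (r * v) (λ j → degree A j * hitting i j) ⟨
        sumℚ n (λ j → r * v * (degree A j * hitting i j))
          ≡⟨ sum-cong n (λ j → ≡.trans (regroup r v (degree A j) (hitting i j))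
               (≡.trans (cong (_* π j) (sym (m-offDiagonal i j))) (sym (offDiagonal-kemeny m π i j)))) ⟩
        sumℚ n (λ j → if ⌊ j ≟ i ⌋ then 0ℚ else m i j * π j) ∎
        where
        regroup : ∀ r v d h → r * v * (d * h) ≡ r * h * (v * d)
        regroup = solve-∀ ring

-- Effect of a new edge on Laplacian, Green function and Kemeny numerator.

module EdgeAddition where

  open import Data.Bool using (true; false; if_then_else_; _∨_; _∧_)
  open import Data.Bool.Properties using (∨-comm; ∧-comm)
  open import Data.Fin using (Fin)
  open import Data.Fin.Properties using (_≟_)
  open import Data.Product using (_,_)
  open import Data.Rational hiding (_≟_; floor)
  open import Data.Rational.Properties hiding (_≟_)
  open import Relation.Binary.PropositionalEquality hiding (trans)
  import Relation.Binary.PropositionalEquality as ≡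
  open import Relation.Nullary using (yes; no; contradiction)
  open import Relation.Nullary.Decidable using (⌊_⌋)
  open import Tactic.RingSolver using (solve-∀)
  open Rationals
  open Sums
  open Kemeny
  open ≡-Reasoning

  degreeSum : ∀ {n} → Adj n → (Fin n → ℚ) → ℚ
  degreeSum {n} A f = sumℚ n (λ x → degree A x * f x)

  degreeSum-cong : ∀ {n} (A : Adj n) {f g : Fin n → ℚ} → (∀ x → f x ≡ g x) → degreeSum A f ≡ degreeSum A g
  degreeSum-cong {n} A eq = sum-cong n (λ x → cong (degree A x *_) (eq x))

  degreeSum-linear : ∀ {n} (A : Adj n) a b (f g : Fin n → ℚ) →
    degreeSum A (λ x → a * f x - b * g x) ≡ a * degreeSum A f - b * degreeSum A g
  degreeSum-linear {n} A a b f g = begin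
    sumℚ n (λ x → degree A x * (a * f x - b * g x))
      ≡⟨ sum-cong n (λ x → distribute (degree A x) a b (f x) (g x)) ⟩
    sumℚ n (λ x → a * (degree A x * f x) - b * (degree A x * g x))
      ≡⟨ sum-- n (λ x → a * (degree A x * f x)) (λ x → b * (degree A x * g x)) ⟩
    sumℚ n (λ x → a * (degree A x * f x)) - sumℚ n (λ x → b * (degree A x * g x))
      ≡⟨ cong₂ _-_ (sum-*ˡ n a (λ x → degree A x * f x)) (sum-*ˡ n b (λ x → degree A x * g x)) ⟩
    a * degreeSum A f - b * degreeSum A g ∎
    where
    distribute : ∀ d a b f g → d * (a * f - b * g) ≡ a * (d * f) - b * (d * g)
    distribute = solve-∀ ring

  volume-degreeSum : ∀ {n} (A : Adj n) → volume A ≡ degreeSum A (λ _ → 1ℚ)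
  volume-degreeSum {n} A = sum-cong n (λ x → sym (*-identityʳ (degree A x)))

  laplacian-cong : ∀ {n} (A : Adj n) {f g : Fin n → ℚ} → (∀ x → f x ≡ g x) → ∀ x → laplacian A f x ≡ laplacian A g x
  laplacian-cong {n} A eq x =
    cong₂ (λ a b → degree A x * a - b) (eq x) (sum-cong n (λ z → cong (weight A x z *_) (eq z)))

  laplacian-linear : ∀ {n} (A : Adj n) a b (f g : Fin n → ℚ) x →
    laplacian A (λ z → a * f z - b * g z) x ≡ a * laplacian A f x - b * laplacian A g x
  laplacian-linear {n} A a b f g x = begin
    degree A x * (a * f x - b * g x) - sumℚ n (λ z → weight A x z * (a * f z - b * g z))
      ≡⟨ cong (λ t → degree A x * (a * f x - b * g x) - t) (begin
           sumℚ n (λ z → weight A x z * (a * f z - b * g z))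
             ≡⟨ sum-cong n (λ z → distribute (weight A x z) a b (f z) (g z)) ⟩
           sumℚ n (λ z → a * (weight A x z * f z) - b * (weight A x z * g z))
             ≡⟨ sum-- n (λ z → a * (weight A x z * f z)) (λ z → b * (weight A x z * g z)) ⟩
           sumℚ n (λ z → a * (weight A x z * f z)) - sumℚ n (λ z → b * (weight A x z * g z))
             ≡⟨ cong₂ _-_ (sum-*ˡ n a (λ z → weight A x z * f z)) (sum-*ˡ n b (λ z → weight A x z * g z)) ⟩
           a * sumℚ n (λ z → weight A x z * f z) - b * sumℚ n (λ z → weight A x z * g z) ∎) ⟩
    degree A x * (a * f x - b * g x) - (a * sumℚ n (λ z → weight A x z * f z) - b * sumℚ n (λ z → weight A x z * g z))
      ≡⟨ regroup (degree A x) a b (f x) (g x) (sumℚ n (λ z → weight A x z * f z)) (sumℚ n (λ z → weight A x z * g z)) ⟩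
    a * laplacian A f x - b * laplacian A g x ∎
    where
    distribute : ∀ d a b f g → d * (a * f - b * g) ≡ a * (d * f) - b * (d * g)
    distribute = solve-∀ ring
    regroup : ∀ d a b f g s t → d * (a * f - b * g) - (a * s - b * t) ≡ a * (d * f - s) - b * (d * g - t)
    regroup = solve-∀ ring

  indicator-∧ : ∀ a b → (if a ∧ b then 1ℚ else 0ℚ) ≡ (if a then 1ℚ else 0ℚ) * (if b then 1ℚ else 0ℚ)
  indicator-∧ true  b = sym (*-identityˡ _)
  indicator-∧ false b = sym (*-zeroˡ (if b then 1ℚ else 0ℚ))

  indicator-∨ : ∀ a b → (b ≡ true → a ≡ false) →
    (if a ∨ b then 1ℚ else 0ℚ) ≡ (if a then 1ℚ else 0ℚ) + (if b then 1ℚ else 0ℚ)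
  indicator-∨ true  true  disjoint = contradiction (disjoint refl) λ ()
  indicator-∨ true  false disjoint = refl
  indicator-∨ false b     disjoint = sym (+-identityˡ _)

  addEdge-sym : ∀ {n} {A : Adj n} → Symmetric A → ∀ u v → Symmetric (addEdge A u v)
  addEdge-sym A-sym u v x y = cong₂ _∨_ (A-sym x y)
    (≡.trans (∨-comm (⌊ x ≟ u ⌋ ∧ ⌊ y ≟ v ⌋) (⌊ x ≟ v ⌋ ∧ ⌊ y ≟ u ⌋))
             (cong₂ _∨_ (∧-comm ⌊ x ≟ v ⌋ ⌊ y ≟ u ⌋) (∧-comm ⌊ x ≟ u ⌋ ⌊ y ≟ v ⌋)))

  addEdge-noIsolated : ∀ {n} {A : Adj n} → NoIsolated A → ∀ u v → NoIsolated (addEdge A u v)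
  addEdge-noIsolated nbr u v x with z , Axz ← nbr x =
    z , cong (_∨ ((⌊ x ≟ u ⌋ ∧ ⌊ z ≟ v ⌋) ∨ (⌊ x ≟ v ⌋ ∧ ⌊ z ≟ u ⌋))) Axz

  module _ {n} {A : Adj n} (A-sym : Symmetric A) {u v : Fin n} (u≢v : u ≢ v) (Auv : A u v ≡ false) where

    -- The disjunction in `addEdge` becomes a sum because its cases exclude each other: `Auv` and
    -- symmetry rule out an old edge, and `u≢v` keeps the two orientations apart.
    weight-addEdge : ∀ x z → weight (addEdge A u v) x z ≡ weight A x z + (δ x u * δ z v + δ x v * δ z u)
    weight-addEdge x z = begin
      weight (addEdge A u v) x z
        ≡⟨ indicator-∨ (A x z) ((⌊ x ≟ u ⌋ ∧ ⌊ z ≟ v ⌋) ∨ (⌊ x ≟ v ⌋ ∧ ⌊ z ≟ u ⌋)) (new x z) ⟩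
      weight A x z + (if (⌊ x ≟ u ⌋ ∧ ⌊ z ≟ v ⌋) ∨ (⌊ x ≟ v ⌋ ∧ ⌊ z ≟ u ⌋) then 1ℚ else 0ℚ)
        ≡⟨ cong (weight A x z +_) (≡.trans
             (indicator-∨ (⌊ x ≟ u ⌋ ∧ ⌊ z ≟ v ⌋) (⌊ x ≟ v ⌋ ∧ ⌊ z ≟ u ⌋) (distinct x z))
             (cong₂ _+_ (indicator-∧ ⌊ x ≟ u ⌋ ⌊ z ≟ v ⌋) (indicator-∧ ⌊ x ≟ v ⌋ ⌊ z ≟ u ⌋))) ⟩
      weight A x z + (δ x u * δ z v + δ x v * δ z u) ∎
      where
      reversed : ∀ x z → ⌊ x ≟ v ⌋ ∧ ⌊ z ≟ u ⌋ ≡ true → A x z ≡ false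
      reversed x z eq with x ≟ v | z ≟ u
      ... | yes refl | yes refl = ≡.trans (A-sym v u) Auv
      new : ∀ x z → (⌊ x ≟ u ⌋ ∧ ⌊ z ≟ v ⌋) ∨ (⌊ x ≟ v ⌋ ∧ ⌊ z ≟ u ⌋) ≡ true → A x z ≡ false
      new x z eq with x ≟ u | z ≟ v
      ... | yes refl | yes refl = Auv
      ... | yes _    | no  _    = reversed x z eq
      ... | no  _    | _        = reversed x z eq
      distinct : ∀ x z → ⌊ x ≟ v ⌋ ∧ ⌊ z ≟ u ⌋ ≡ true → ⌊ x ≟ u ⌋ ∧ ⌊ z ≟ v ⌋ ≡ false
      distinct x z eq with x ≟ u | x ≟ v
      ... | yes refl | yes u≡v = contradiction u≡v u≢v
      ... | no  _    | _       = refl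

    weightSum-addEdge : ∀ x (f : Fin n → ℚ) → sumℚ n (λ z → weight (addEdge A u v) x z * f z) ≡
      sumℚ n (λ z → weight A x z * f z) + (δ x u * f v + δ x v * f u)
    weightSum-addEdge x f = begin
      sumℚ n (λ z → weight (addEdge A u v) x z * f z)
        ≡⟨ sum-cong n (λ z → ≡.trans (cong (_* f z) (weight-addEdge x z))
             (distribute (weight A x z) (δ x u) (δ z v) (δ x v) (δ z u) (f z))) ⟩
      sumℚ n (λ z → weight A x z * f z + (δ z v * (δ x u * f z) + δ z u * (δ x v * f z)))
        ≡⟨ sum-+ n (λ z → weight A x z * f z) (λ z → δ z v * (δ x u * f z) + δ z u * (δ x v * f z)) ⟩
      sumℚ n (λ z → weight A x z * f z) + sumℚ n (λ z → δ z v * (δ x u * f z) + δ z u * (δ x v * f z))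
        ≡⟨ cong (sumℚ n (λ z → weight A x z * f z) +_) (≡.trans
             (sum-+ n (λ z → δ z v * (δ x u * f z)) (λ z → δ z u * (δ x v * f z)))
             (cong₂ _+_ (sum-δ v (λ z → δ x u * f z)) (sum-δ u (λ z → δ x v * f z)))) ⟩
      sumℚ n (λ z → weight A x z * f z) + (δ x u * f v + δ x v * f u) ∎
      where
      distribute : ∀ w a b c d f → (w + (a * b + c * d)) * f ≡ w * f + (b * (a * f) + d * (c * f))
      distribute = solve-∀ ring

    degree-addEdge : ∀ x → degree (addEdge A u v) x ≡ degree A x + (δ x u + δ x v)
    degree-addEdge x = begin
      degree (addEdge A u v) x
        ≡⟨ sum-cong n (λ z → sym (*-identityʳ (weight (addEdge A u v) x z))) ⟩
      sumℚ n (λ z → weight (addEdge A u v) x z * 1ℚ)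
        ≡⟨ weightSum-addEdge x (λ _ → 1ℚ) ⟩
      sumℚ n (λ z → weight A x z * 1ℚ) + (δ x u * 1ℚ + δ x v * 1ℚ)
        ≡⟨ cong₂ _+_ (sum-cong n (λ z → *-identityʳ (weight A x z)))
                     (cong₂ _+_ (*-identityʳ (δ x u)) (*-identityʳ (δ x v))) ⟩
      degree A x + (δ x u + δ x v) ∎

    degreeSum-addEdge : ∀ (f : Fin n → ℚ) → degreeSum (addEdge A u v) f ≡ degreeSum A f + (f u + f v)
    degreeSum-addEdge f = begin
      degreeSum (addEdge A u v) f
        ≡⟨ sum-cong n (λ x → ≡.trans (cong (_* f x) (degree-addEdge x))
             (distribute (degree A x) (δ x u) (δ x v) (f x))) ⟩
      sumℚ n (λ x → degree A x * f x + (δ x u * f x + δ x v * f x))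
        ≡⟨ sum-+ n (λ x → degree A x * f x) (λ x → δ x u * f x + δ x v * f x) ⟩
      degreeSum A f + sumℚ n (λ x → δ x u * f x + δ x v * f x)
        ≡⟨ cong (degreeSum A f +_) (≡.trans (sum-+ n (λ x → δ x u * f x) (λ x → δ x v * f x))
             (cong₂ _+_ (sum-δ u f) (sum-δ v f))) ⟩
      degreeSum A f + (f u + f v) ∎
      where
      distribute : ∀ d a b f → (d + (a + b)) * f ≡ d * f + (a * f + b * f)
      distribute = solve-∀ ring

    volume-addEdge : volume (addEdge A u v) ≡ volume A + ι 2
    volume-addEdge = ≡.trans (volume-degreeSum (addEdge A u v)) (≡.trans (degreeSum-addEdge (λ _ → 1ℚ))
      (cong (_+ ι 2) (sym (volume-degreeSum A))))

    -- The perturbation is the rank-one form w wᵀ with w = δ_u - δ_v, which is what makes a closed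
    -- update of Γ possible.
    laplacian-addEdge : ∀ (f : Fin n → ℚ) x →
      laplacian (addEdge A u v) f x ≡ laplacian A f x + (δ x u - δ x v) * (f u - f v)
    laplacian-addEdge f x = begin
      degree (addEdge A u v) x * f x - sumℚ n (λ z → weight (addEdge A u v) x z * f z)
        ≡⟨ cong₂ (λ a b → a * f x - b) (degree-addEdge x) (weightSum-addEdge x f) ⟩
      (degree A x + (δ x u + δ x v)) * f x - (W + (δ x u * f v + δ x v * f u))
        ≡⟨ expand (degree A x) (δ x u) (δ x v) (f x) (f u) (f v) W ⟩
      degree A x * f x + (δ x u * f x + δ x v * f x) - (W + (δ x u * f v + δ x v * f u))
        ≡⟨ cong₂ (λ a b → degree A x * f x + (a + b) - (W + (δ x u * f v + δ x v * f u)))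
             (δ-transport x u f) (δ-transport x v f) ⟩
      degree A x * f x + (δ x u * f u + δ x v * f v) - (W + (δ x u * f v + δ x v * f u))
        ≡⟨ collect (degree A x * f x) (δ x u) (δ x v) (f u) (f v) W ⟩
      laplacian A f x + (δ x u - δ x v) * (f u - f v) ∎
      where
      W = sumℚ n (λ z → weight A x z * f z)
      expand : ∀ d a b f g h w → (d + (a + b)) * f - (w + (a * h + b * g)) ≡ d * f + (a * f + b * f) - (w + (a * h + b * g))
      expand = solve-∀ ring
      collect : ∀ d a b g h w → d + (a * g + b * h) - (w + (a * h + b * g)) ≡ d - w + (a - b) * (g - h)
      collect = solve-∀ ring

    module _ {σ q Γ} (nbr : NoIsolated A) (green : IsGreen A σ q Γ) where

      open IsGreen green

      -- The voltage, scaled by σ, of a unit current entering at u and leaving at v. The factors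
      -- `1ℚ` make it a literal instance of `laplacian-linear` and `degreeSum-linear`.
      dipole : Fin n → ℚ
      dipole x = 1ℚ * Γ x u - 1ℚ * Γ x v

      -- σ times the effective resistance between u and v.
      resistance : ℚ
      resistance = dipole u - dipole v

      -- Sherman–Morrison for the rank-one perturbation of the Laplacian, cleared of its denominator.
      Γ⁺ : Fin n → Fin n → ℚ
      Γ⁺ x y = (σ + resistance) * Γ x y - dipole y * dipole x

      laplacian-dipole : ∀ x → laplacian A dipole x ≡ σ * (δ x u - δ x v)
      laplacian-dipole x = begin
        laplacian A dipole x
          ≡⟨ laplacian-linear A 1ℚ 1ℚ (λ z → Γ z u) (λ z → Γ z v) x ⟩
        1ℚ * laplacian A (λ z → Γ z u) x - 1ℚ * laplacian A (λ z → Γ z v) x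
          ≡⟨ cong₂ (λ a b → 1ℚ * a - 1ℚ * b) (Γ-laplacian x u) (Γ-laplacian x v) ⟩
        1ℚ * (σ * δ x u - q x) - 1ℚ * (σ * δ x v - q x)
          ≡⟨ lemma σ (δ x u) (δ x v) (q x) ⟩
        σ * (δ x u - δ x v) ∎
        where
        lemma : ∀ s a b q → 1ℚ * (s * a - q) - 1ℚ * (s * b - q) ≡ s * (a - b)
        lemma = solve-∀ ring

      -- Between u and v the column y of `Γ⁺` drops by (σ + ρ) - ρ = σ times `dipole y`. Hence the
      -- rank-one term of the new Laplacian cancels the Laplacian of the correction, and only the
      -- scaled old equation is left.
      green-addEdge : IsGreen (addEdge A u v) ((σ + resistance) * σ) (λ x → (σ + resistance) * q x) Γ⁺
      green-addEdge = record { Γ-sym = symmetric ; Γ-laplacian = fundamental }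
        where
        ρ = resistance
        symmetric : ∀ x y → Γ⁺ x y ≡ Γ⁺ y x
        symmetric x y = cong₂ (λ a b → (σ + ρ) * a - b) (Γ-sym x y) (*-comm (dipole y) (dipole x))
        fundamental : ∀ x y → laplacian (addEdge A u v) (λ z → Γ⁺ z y) x ≡ (σ + ρ) * σ * δ x y - (σ + ρ) * q x
        fundamental x y = begin
          laplacian (addEdge A u v) (λ z → Γ⁺ z y) x
            ≡⟨ laplacian-addEdge (λ z → Γ⁺ z y) x ⟩
          laplacian A (λ z → Γ⁺ z y) x + (δ x u - δ x v) * (Γ⁺ u y - Γ⁺ v y)
            ≡⟨ cong (_+ (δ x u - δ x v) * (Γ⁺ u y - Γ⁺ v y))
                 (laplacian-linear A (σ + ρ) (dipole y) (λ z → Γ z y) dipole x) ⟩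
          (σ + ρ) * laplacian A (λ z → Γ z y) x - dipole y * laplacian A dipole x + (δ x u - δ x v) * (Γ⁺ u y - Γ⁺ v y)
            ≡⟨ cong₂ (λ a b → (σ + ρ) * a - dipole y * b + (δ x u - δ x v) * (Γ⁺ u y - Γ⁺ v y))
                 (Γ-laplacian x y) (laplacian-dipole x) ⟩
          (σ + ρ) * (σ * δ x y - q x) - dipole y * (σ * (δ x u - δ x v)) + (δ x u - δ x v) * (Γ⁺ u y - Γ⁺ v y)
            ≡⟨ cong (λ t → (σ + ρ) * (σ * δ x y - q x) - dipole y * (σ * (δ x u - δ x v)) + (δ x u - δ x v) * t)
                 difference ⟩
          (σ + ρ) * (σ * δ x y - q x) - dipole y * (σ * (δ x u - δ x v)) + (δ x u - δ x v) * (σ * dipole y)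
            ≡⟨ cancel σ ρ (δ x y) (q x) (dipole y) (δ x u - δ x v) ⟩
          (σ + ρ) * σ * δ x y - (σ + ρ) * q x ∎
          where
          difference : Γ⁺ u y - Γ⁺ v y ≡ σ * dipole y
          difference = begin
            Γ⁺ u y - Γ⁺ v y
              ≡⟨ cong₂ (λ a b → (σ + ρ) * a - dipole y * dipole u - ((σ + ρ) * b - dipole y * dipole v)) (Γ-sym u y) (Γ-sym v y) ⟩
            (σ + ρ) * Γ y u - dipole y * dipole u - ((σ + ρ) * Γ y v - dipole y * dipole v)
              ≡⟨ lemma σ (Γ y u) (Γ y v) (dipole u) (dipole v) ⟩
            σ * dipole y ∎
            where
            lemma : ∀ s a b g h → (s + (g - h)) * a - (1ℚ * a - 1ℚ * b) * g - ((s + (g - h)) * b - (1ℚ * a - 1ℚ * b) * h)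
                                  ≡ s * (1ℚ * a - 1ℚ * b)
            lemma = solve-∀ ring
          cancel : ∀ s r e q g w → (s + r) * (s * e - q) - g * (s * w) + w * (s * g) ≡ (s + r) * s * e - (s + r) * q
          cancel = solve-∀ ring

      private
        A⁺ = addEdge A u v
        A⁺-sym = addEdge-sym A-sym u v
        nbr⁺ = addEdge-noIsolated {A = A} nbr u v
        φ = potential A-sym nbr green
        ρ = resistance

      degreeSum-dipole : degreeSum A dipole ≡ φ u - φ v
      degreeSum-dipole = begin
        degreeSum A dipole
          ≡⟨ degreeSum-linear A 1ℚ 1ℚ (λ x → Γ x u) (λ x → Γ x v) ⟩
        1ℚ * degreeSum A (λ x → Γ x u) - 1ℚ * degreeSum A (λ x → Γ x v)
          ≡⟨ cong₂ (λ a b → 1ℚ * a - 1ℚ * b) (degreeSum-cong A (λ x → Γ-sym x u)) (degreeSum-cong A (λ x → Γ-sym x v)) ⟩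
        1ℚ * φ u - 1ℚ * φ v
          ≡⟨ cong₂ _-_ (*-identityˡ (φ u)) (*-identityˡ (φ v)) ⟩
        φ u - φ v ∎

      -- The sum of `dipole` weighted by the degrees after the edge has been added.
      dipoleMoment : ℚ
      dipoleMoment = φ u - φ v + (dipole u + dipole v)

      potential-addEdge : ∀ x → potential A⁺-sym nbr⁺ green-addEdge x ≡
        (σ + ρ) * (φ x + (Γ x u + Γ x v)) - dipoleMoment * dipole x
      potential-addEdge x = begin
        degreeSum A⁺ (λ y → Γ⁺ x y)
          ≡⟨ degreeSum-cong A⁺ (λ y → cong (λ t → (σ + ρ) * Γ x y - t) (*-comm (dipole y) (dipole x))) ⟩
        degreeSum A⁺ (λ y → (σ + ρ) * Γ x y - dipole x * dipole y)
          ≡⟨ degreeSum-linear A⁺ (σ + ρ) (dipole x) (Γ x) dipole ⟩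
        (σ + ρ) * degreeSum A⁺ (Γ x) - dipole x * degreeSum A⁺ dipole
          ≡⟨ cong₂ (λ a b → (σ + ρ) * a - dipole x * b) (degreeSum-addEdge (Γ x))
               (≡.trans (degreeSum-addEdge dipole) (cong (_+ (dipole u + dipole v)) degreeSum-dipole)) ⟩
        (σ + ρ) * (φ x + (Γ x u + Γ x v)) - dipole x * dipoleMoment
          ≡⟨ cong (λ t → (σ + ρ) * (φ x + (Γ x u + Γ x v)) - t) (*-comm (dipole x) dipoleMoment) ⟩
        (σ + ρ) * (φ x + (Γ x u + Γ x v)) - dipoleMoment * dipole x ∎

      degreeSum-potential-addEdge : degreeSum A⁺ (potential A⁺-sym nbr⁺ green-addEdge) ≡
        (σ + ρ) * (degreeSum A φ + ι 2 * (φ u + φ v) + (Γ u u + ι 2 * Γ u v + Γ v v)) - dipoleMoment * dipoleMoment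
      degreeSum-potential-addEdge = begin
        degreeSum A⁺ (potential A⁺-sym nbr⁺ green-addEdge)
          ≡⟨ degreeSum-cong A⁺ potential-addEdge ⟩
        degreeSum A⁺ (λ x → (σ + ρ) * ψ x - dipoleMoment * dipole x)
          ≡⟨ degreeSum-linear A⁺ (σ + ρ) dipoleMoment ψ dipole ⟩
        (σ + ρ) * degreeSum A⁺ ψ - dipoleMoment * degreeSum A⁺ dipole
          ≡⟨ cong₂ (λ a b → (σ + ρ) * a - dipoleMoment * b) sum-ψ
               (≡.trans (degreeSum-addEdge dipole) (cong (_+ (dipole u + dipole v)) degreeSum-dipole)) ⟩
        (σ + ρ) * (degreeSum A φ + ι 2 * (φ u + φ v) + (Γ u u + ι 2 * Γ u v + Γ v v)) - dipoleMoment * dipoleMoment ∎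
        where
        ψ : Fin n → ℚ
        ψ x = φ x + (Γ x u + Γ x v)
        distribute : ∀ d p g h → d * (p + (g + h)) ≡ d * p + (d * g + d * h)
        distribute = solve-∀ ring
        collect : ∀ s p r a b c → s + (p + r) + ((p + (a + b)) + (r + (b + c))) ≡ s + ι 2 * (p + r) + (a + ι 2 * b + c)
        collect = solve-∀ ring
        sum-ψ : degreeSum A⁺ ψ ≡ degreeSum A φ + ι 2 * (φ u + φ v) + (Γ u u + ι 2 * Γ u v + Γ v v)
        sum-ψ = begin
          degreeSum A⁺ ψ
            ≡⟨ degreeSum-addEdge ψ ⟩
          degreeSum A ψ + (ψ u + ψ v)
            ≡⟨ cong (_+ (ψ u + ψ v)) (begin
                 degreeSum A ψ
                   ≡⟨ sum-cong n (λ x → distribute (degree A x) (φ x) (Γ x u) (Γ x v)) ⟩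
                 sumℚ n (λ x → degree A x * φ x + (degree A x * Γ x u + degree A x * Γ x v))
                   ≡⟨ sum-+ n (λ x → degree A x * φ x) (λ x → degree A x * Γ x u + degree A x * Γ x v) ⟩
                 degreeSum A φ + sumℚ n (λ x → degree A x * Γ x u + degree A x * Γ x v)
                   ≡⟨ cong (degreeSum A φ +_) (sum-+ n (λ x → degree A x * Γ x u) (λ x → degree A x * Γ x v)) ⟩
                 degreeSum A φ + (degreeSum A (λ x → Γ x u) + degreeSum A (λ x → Γ x v))
                   ≡⟨ cong₂ (λ a b → degreeSum A φ + (a + b))
                        (degreeSum-cong A (λ x → Γ-sym x u)) (degreeSum-cong A (λ x → Γ-sym x v)) ⟩
                 degreeSum A φ + (φ u + φ v) ∎) ⟩
          degreeSum A φ + (φ u + φ v) + (ψ u + ψ v)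
            ≡⟨ cong (λ t → degreeSum A φ + (φ u + φ v) + (ψ u + (φ v + (t + Γ v v)))) (Γ-sym v u) ⟩
          degreeSum A φ + (φ u + φ v) + (ψ u + (φ v + (Γ u v + Γ v v)))
            ≡⟨ collect (degreeSum A φ) (φ u) (φ v) (Γ u u) (Γ u v) (Γ v v) ⟩
          degreeSum A φ + ι 2 * (φ u + φ v) + (Γ u u + ι 2 * Γ u v + Γ v v) ∎

      -- Expresses the new numerator through sums over the old degrees and values at u and v, so
      -- that for the path no sum over the modified graph has to be evaluated.
      kemenyNumerator-addEdge : kemenyNumerator A⁺-sym nbr⁺ green-addEdge ≡
        (volume A + ι 2) *
          ((σ + ρ) * (degreeSum A (λ x → Γ x x) + (Γ u u + Γ v v))
           - (degreeSum A (λ x → dipole x * dipole x) + (dipole u * dipole u + dipole v * dipole v)))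
        - ((σ + ρ) * (degreeSum A φ + ι 2 * (φ u + φ v) + (Γ u u + ι 2 * Γ u v + Γ v v)) - dipoleMoment * dipoleMoment)
      kemenyNumerator-addEdge = cong₂ _-_ (cong₂ _*_ volume-addEdge (begin
        degreeSum A⁺ (λ x → Γ⁺ x x)
          ≡⟨ degreeSum-cong A⁺ (λ x → cong (λ t → (σ + ρ) * Γ x x - t) (sym (*-identityˡ (dipole x * dipole x)))) ⟩
        degreeSum A⁺ (λ x → (σ + ρ) * Γ x x - 1ℚ * (dipole x * dipole x))
          ≡⟨ degreeSum-linear A⁺ (σ + ρ) 1ℚ (λ x → Γ x x) (λ x → dipole x * dipole x) ⟩
        (σ + ρ) * degreeSum A⁺ (λ x → Γ x x) - 1ℚ * degreeSum A⁺ (λ x → dipole x * dipole x)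
          ≡⟨ cong₂ (λ a b → (σ + ρ) * a - b) (degreeSum-addEdge (λ x → Γ x x))
               (≡.trans (*-identityˡ _) (degreeSum-addEdge (λ x → dipole x * dipole x))) ⟩
        (σ + ρ) * (degreeSum A (λ x → Γ x x) + (Γ u u + Γ v v))
        - (degreeSum A (λ x → dipole x * dipole x) + (dipole u * dipole u + dipole v * dipole v)) ∎))
        degreeSum-potential-addEdge

-- The path: degree sums as sums over edges, and its Green function.

module Path where

  open import Data.Bool.Properties using (∨-comm)
  open import Data.Fin as F using (Fin; toℕ; fromℕ)
  open import Data.Nat as ℕ using (ℕ; zero; suc; ∣_-_∣)
  import Data.Nat.Properties as ℕₚ
  open import Data.Product using (_,_)
  open import Data.Rational hiding (_≟_; floor; ∣_∣)
  open import Data.Rational.Properties hiding (_≟_)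
  open import Relation.Binary.PropositionalEquality hiding (trans)
  import Relation.Binary.PropositionalEquality as ≡
  open import Tactic.RingSolver using (solve-∀)
  open Rationals
  open Sums
  open Kemeny
  open EdgeAddition
  open ≡-Reasoning

  ι-suc : ∀ n → ι (suc n) ≡ 1ℚ + ι n
  ι-suc = ι-+ 1

  ι-∸ : ∀ {m n} → m ℕ.≤ n → ι (n ℕ.∸ m) ≡ ι n - ι m
  ι-∸ {m} {n} m≤n = begin
    ι (n ℕ.∸ m)                   ≡⟨ lemma (ι (n ℕ.∸ m)) (ι m) ⟩
    ι (n ℕ.∸ m) + ι m - ι m       ≡⟨ cong (_- ι m) (ι-+ (n ℕ.∸ m) m) ⟨
    ι (n ℕ.∸ m ℕ.+ m) - ι m       ≡⟨ cong (λ t → ι t - ι m) (ℕₚ.m∸n+n≡m m≤n) ⟩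
    ι n - ι m                     ∎
    where
    lemma : ∀ x y → x ≡ x + y - y
    lemma = solve-∀ ring

  ι-dist-≤ : ∀ {m n} → m ℕ.≤ n → ι ∣ m - n ∣ ≡ ι n - ι m
  ι-dist-≤ m≤n = ≡.trans (cong ι (ℕₚ.m≤n⇒∣m-n∣≡n∸m m≤n)) (ι-∸ m≤n)

  path-sym : ∀ k → Symmetric (pathAdj k)
  path-sym k x y = ∨-comm ((toℕ x ℕ.+ 1) ℕ.≡ᵇ toℕ y) ((toℕ y ℕ.+ 1) ℕ.≡ᵇ toℕ x)

  path-noIsolated : ∀ k → NoIsolated (pathAdj (suc (suc k)))
  path-noIsolated k       F.zero            = F.suc F.zero , refl
  path-noIsolated k       (F.suc F.zero)    = F.zero , refl
  path-noIsolated (suc k) (F.suc (F.suc x)) with z , eq ← path-noIsolated k (F.suc x) = F.suc z , eq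

  -- Runs over the `n` edges from t to t + 1 and adds `f` at both ends. By handshaking this is the
  -- degree-weighted sum, without the exceptional degrees of the end vertices.
  edgeSum : ℕ → (ℕ → ℚ) → ℚ
  edgeSum zero    f = 0ℚ
  edgeSum (suc n) f = f 0 + f 1 + edgeSum n (λ t → f (suc t))

  weight-suc-zero : ∀ {k} (x : Fin (suc k)) → weight (pathAdj (suc (suc k))) (F.suc x) F.zero ≡ δ x F.zero
  weight-suc-zero F.zero    = refl
  weight-suc-zero (F.suc x) = refl

  degree-zero : ∀ k → degree (pathAdj (suc (suc k))) F.zero ≡ 1ℚ
  degree-zero k = cong (λ t → 0ℚ + (1ℚ + t)) (sum-0 k)

  -- Removing the first vertex leaves a shorter path, in which only the vertex next to it has lost a
  -- neighbour. All inductions on the path rest on this.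
  degree-suc : ∀ {k} (x : Fin (suc k)) →
    degree (pathAdj (suc (suc k))) (F.suc x) ≡ δ x F.zero + degree (pathAdj (suc k)) x
  degree-suc {k} x = cong (_+ degree (pathAdj (suc k)) x) (weight-suc-zero x)

  degreeSum-path : ∀ n (f : ℕ → ℚ) → degreeSum (pathAdj (suc n)) (λ x → f (toℕ x)) ≡ edgeSum n f
  degreeSum-path zero    f = lemma (f 0)
    where
    lemma : ∀ x → (0ℚ + 0ℚ) * x + 0ℚ ≡ 0ℚ
    lemma = solve-∀ ring
  degreeSum-path (suc n) f = begin
    degree P⁺ F.zero * f 0 + sumℚ (suc n) (λ x → degree P⁺ (F.suc x) * f (suc (toℕ x)))
      ≡⟨ cong₂ (λ a b → a * f 0 + b) (degree-zero n) (begin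
           sumℚ (suc n) (λ x → degree P⁺ (F.suc x) * f (suc (toℕ x)))
             ≡⟨ sum-cong (suc n) (λ x → ≡.trans (cong (_* f (suc (toℕ x))) (degree-suc x))
                  (*-distribʳ-+ (f (suc (toℕ x))) (δ x F.zero) (degree P x))) ⟩
           sumℚ (suc n) (λ x → δ x F.zero * f (suc (toℕ x)) + degree P x * f (suc (toℕ x)))
             ≡⟨ sum-+ (suc n) (λ x → δ x F.zero * f (suc (toℕ x))) (λ x → degree P x * f (suc (toℕ x))) ⟩
           sumℚ (suc n) (λ x → δ x F.zero * f (suc (toℕ x))) + degreeSum P (λ x → f (suc (toℕ x)))
             ≡⟨ cong₂ _+_ (sum-δ {suc n} F.zero (λ x → f (suc (toℕ x)))) (degreeSum-path n (λ t → f (suc t))) ⟩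
           f 1 + edgeSum n (λ t → f (suc t)) ∎) ⟩
    1ℚ * f 0 + (f 1 + edgeSum n (λ t → f (suc t)))
      ≡⟨ lemma (f 0) (f 1) (edgeSum n (λ t → f (suc t))) ⟩
    edgeSum (suc n) f ∎
    where
    P  = pathAdj (suc n)
    P⁺ = pathAdj (suc (suc n))
    lemma : ∀ a b c → 1ℚ * a + (b + c) ≡ a + b + c
    lemma = solve-∀ ring

  laplacian-path-zero : ∀ n (f : ℕ → ℚ) → laplacian (pathAdj (suc (suc n))) (λ x → f (toℕ x)) F.zero ≡ f 0 - f 1
  laplacian-path-zero n f = begin
    degree (pathAdj (suc (suc n))) F.zero * f 0 - (0ℚ * f 0 + (1ℚ * f 1 + sumℚ n (λ z → 0ℚ * f (suc (suc (toℕ z))))))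
      ≡⟨ cong₂ (λ a b → a * f 0 - (0ℚ * f 0 + (1ℚ * f 1 + b))) (degree-zero n)
           (sum-*ˡ n 0ℚ (λ z → f (suc (suc (toℕ z))))) ⟩
    1ℚ * f 0 - (0ℚ * f 0 + (1ℚ * f 1 + 0ℚ * sumℚ n (λ z → f (suc (suc (toℕ z))))))
      ≡⟨ lemma (f 0) (f 1) (sumℚ n (λ z → f (suc (suc (toℕ z))))) ⟩
    f 0 - f 1 ∎
    where
    lemma : ∀ a b c → 1ℚ * a - (0ℚ * a + (1ℚ * b + 0ℚ * c)) ≡ a - b
    lemma = solve-∀ ring

  laplacian-path-suc : ∀ n (f : ℕ → ℚ) x → laplacian (pathAdj (suc (suc n))) (λ z → f (toℕ z)) (F.suc x) ≡
    δ x F.zero * (f 1 - f 0) + laplacian (pathAdj (suc n)) (λ z → f (suc (toℕ z))) x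
  laplacian-path-suc n f x = begin
    degree P⁺ (F.suc x) * fx - (weight P⁺ (F.suc x) F.zero * f 0 + W)
      ≡⟨ cong₂ (λ a b → a * fx - (b * f 0 + W)) (degree-suc x) (weight-suc-zero x) ⟩
    (δ x F.zero + degree P x) * fx - (δ x F.zero * f 0 + W)
      ≡⟨ expand (δ x F.zero) (degree P x) fx (f 0) W ⟩
    δ x F.zero * fx - δ x F.zero * f 0 + (degree P x * fx - W)
      ≡⟨ cong (λ t → t - δ x F.zero * f 0 + (degree P x * fx - W)) (δ-transport x F.zero (λ z → f (suc (toℕ z)))) ⟩
    δ x F.zero * f 1 - δ x F.zero * f 0 + (degree P x * fx - W)
      ≡⟨ cong (_+ (degree P x * fx - W)) (factor (δ x F.zero) (f 1) (f 0)) ⟩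
    δ x F.zero * (f 1 - f 0) + laplacian P (λ z → f (suc (toℕ z))) x ∎
    where
    P  = pathAdj (suc n)
    P⁺ = pathAdj (suc (suc n))
    fx = f (suc (toℕ x))
    W = sumℚ (suc n) (λ z → weight P x z * f (suc (toℕ z)))
    expand : ∀ e d a b w → (e + d) * a - (e * b + w) ≡ e * a - e * b + (d * a - w)
    expand = solve-∀ ring
    factor : ∀ e a b → e * a - e * b ≡ e * (a - b)
    factor = solve-∀ ring

  laplacian-shift : ∀ {n} (A : Adj n) c (f : Fin n → ℚ) x → laplacian A (λ z → f z - c) x ≡ laplacian A f x
  laplacian-shift {n} A c f x = begin
    degree A x * (f x - c) - sumℚ n (λ z → weight A x z * (f z - c))
      ≡⟨ cong (λ t → degree A x * (f x - c) - t) (begin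
           sumℚ n (λ z → weight A x z * (f z - c))
             ≡⟨ sum-cong n (λ z → expand (weight A x z) (f z) c) ⟩
           sumℚ n (λ z → weight A x z * f z - weight A x z * c)
             ≡⟨ sum-- n (λ z → weight A x z * f z) (λ z → weight A x z * c) ⟩
           sumℚ n (λ z → weight A x z * f z) - sumℚ n (λ z → weight A x z * c)
             ≡⟨ cong (λ t → sumℚ n (λ z → weight A x z * f z) - t) (sum-*ʳ n c (weight A x)) ⟩
           sumℚ n (λ z → weight A x z * f z) - degree A x * c ∎) ⟩
    degree A x * (f x - c) - (sumℚ n (λ z → weight A x z * f z) - degree A x * c)
      ≡⟨ collect (degree A x) (f x) c (sumℚ n (λ z → weight A x z * f z)) ⟩
    laplacian A f x ∎
    where
    expand : ∀ w a c → w * (a - c) ≡ w * a - w * c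
    expand = solve-∀ ring
    collect : ∀ d a c s → d * (a - c) - (s - d * c) ≡ d * a - s
    collect = solve-∀ ring

  pathΓ : ∀ {n} → Fin n → Fin n → ℚ
  pathΓ x y = - ι ∣ toℕ x - toℕ y ∣

  -- At an end of the path the slope of -|x - y| has no neighbour to balance it. These two units
  -- form the defect, with total σ = 2.
  endpoints : ∀ {n} → Fin (suc n) → ℚ
  endpoints {n} x = δ x F.zero + δ x (fromℕ n)

  -- Induction by removing the first vertex. The edge cut off contributes at its other end; for a
  -- pole y beyond the first vertex this is one unit, which cancels the end defect of the shorter
  -- path.
  pathΓ-laplacian : ∀ n (x y : Fin (suc n)) →
    laplacian (pathAdj (suc n)) (λ z → pathΓ z y) x ≡ ι 2 * δ x y - endpoints x
  pathΓ-laplacian zero    F.zero    F.zero    = refl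
  pathΓ-laplacian (suc n) F.zero    F.zero    = laplacian-path-zero n (λ t → - ι ∣ t - 0 ∣)
  pathΓ-laplacian (suc n) F.zero    (F.suc y) = begin
    laplacian (pathAdj (suc (suc n))) (λ z → pathΓ z (F.suc y)) F.zero
      ≡⟨ laplacian-path-zero n (λ t → - ι ∣ t - suc (toℕ y) ∣) ⟩
    - ι (suc (toℕ y)) - - ι (toℕ y)
      ≡⟨ cong (λ t → - t - - ι (toℕ y)) (ι-suc (toℕ y)) ⟩
    - (1ℚ + ι (toℕ y)) - - ι (toℕ y)
      ≡⟨ lemma (ι (toℕ y)) ⟩
    ι 2 * 0ℚ - (1ℚ + 0ℚ) ∎
    where
    lemma : ∀ x → - (1ℚ + x) - - x ≡ ι 2 * 0ℚ - (1ℚ + 0ℚ)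
    lemma = solve-∀ ring
  pathΓ-laplacian (suc n) (F.suc x) F.zero    = begin
    laplacian (pathAdj (suc (suc n))) (λ z → pathΓ z F.zero) (F.suc x)
      ≡⟨ laplacian-path-suc n (λ t → - ι ∣ t - 0 ∣) x ⟩
    δ x F.zero * (- ι 1 - - ι 0) + laplacian (pathAdj (suc n)) (λ z → - ι (suc (toℕ z))) x
      -- With the pole at the removed vertex, the column is that of the shorter path with pole at
      -- its new first vertex, lowered by the constant 1, which the Laplacian kills.
      ≡⟨ cong (δ x F.zero * (- ι 1 - - ι 0) +_) (≡.trans
           (laplacian-cong (pathAdj (suc n)) shift x)
           (≡.trans (laplacian-shift (pathAdj (suc n)) 1ℚ (λ z → pathΓ z F.zero) x) (pathΓ-laplacian n x F.zero))) ⟩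
    δ x F.zero * (- ι 1 - - ι 0) + (ι 2 * δ x F.zero - (δ x F.zero + δ x (fromℕ n)))
      ≡⟨ lemma (δ x F.zero) (δ x (fromℕ n)) ⟩
    ι 2 * 0ℚ - (0ℚ + δ x (fromℕ n))
      ≡⟨ cong (λ t → ι 2 * 0ℚ - (0ℚ + t)) (δ-suc x (fromℕ n)) ⟨
    ι 2 * 0ℚ - (0ℚ + δ (F.suc x) (fromℕ (suc n))) ∎
    where
    negate : ∀ a → - (1ℚ + a) ≡ - a - 1ℚ
    negate = solve-∀ ring
    shift : ∀ (z : Fin (suc n)) → - ι (suc (toℕ z)) ≡ pathΓ z F.zero - 1ℚ
    shift z = ≡.trans (cong -_ (ι-suc (toℕ z))) (≡.trans (negate (ι (toℕ z)))
      (cong (λ t → - ι t - 1ℚ) (sym (ℕₚ.∣-∣-identityʳ (toℕ z)))))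
    lemma : ∀ e l → e * (- ι 1 - - ι 0) + (ι 2 * e - (e + l)) ≡ ι 2 * 0ℚ - (0ℚ + l)
    lemma = solve-∀ ring
  pathΓ-laplacian (suc n) (F.suc x) (F.suc y) = begin
    laplacian (pathAdj (suc (suc n))) (λ z → pathΓ z (F.suc y)) (F.suc x)
      ≡⟨ laplacian-path-suc n (λ t → - ι ∣ t - suc (toℕ y) ∣) x ⟩
    δ x F.zero * (- ι (toℕ y) - - ι (suc (toℕ y))) + laplacian (pathAdj (suc n)) (λ z → pathΓ z y) x
      ≡⟨ cong₂ (λ a b → δ x F.zero * (- ι (toℕ y) - - a) + b) (ι-suc (toℕ y)) (pathΓ-laplacian n x y) ⟩
    δ x F.zero * (- ι (toℕ y) - - (1ℚ + ι (toℕ y))) + (ι 2 * δ x y - (δ x F.zero + δ x (fromℕ n)))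
      ≡⟨ lemma (δ x F.zero) (δ x y) (δ x (fromℕ n)) (ι (toℕ y)) ⟩
    ι 2 * δ x y - (0ℚ + δ x (fromℕ n))
      ≡⟨ cong₂ (λ a b → ι 2 * a - (0ℚ + b)) (δ-suc x y) (δ-suc x (fromℕ n)) ⟨
    ι 2 * δ (F.suc x) (F.suc y) - (0ℚ + δ (F.suc x) (fromℕ (suc n))) ∎
    where
    lemma : ∀ e d l y → e * (- y - - (1ℚ + y)) + (ι 2 * d - (e + l)) ≡ ι 2 * d - (0ℚ + l)
    lemma = solve-∀ ring

  path-green : ∀ n → IsGreen (pathAdj (suc n)) (ι 2) endpoints pathΓ
  path-green n = record
    { Γ-sym       = λ x y → cong (λ t → - ι t) (ℕₚ.∣-∣-comm (toℕ x) (toℕ y))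
    ; Γ-laplacian = pathΓ-laplacian n
    }

  edgeSum-cong : ∀ n {f g : ℕ → ℚ} → (∀ t → t ℕ.≤ n → f t ≡ g t) → edgeSum n f ≡ edgeSum n g
  edgeSum-cong zero    eq = refl
  edgeSum-cong (suc n) eq = cong₂ _+_
    (cong₂ _+_ (eq 0 ℕ.z≤n) (eq 1 (ℕ.s≤s ℕ.z≤n)))
    (edgeSum-cong n (λ t t≤n → eq (suc t) (ℕ.s≤s t≤n)))

  -- Cutting at vertex m splits the set of edges, so m occurs in both parts and no boundary
  -- correction arises.
  edgeSum-split : ∀ m n (f : ℕ → ℚ) → edgeSum (m ℕ.+ n) f ≡ edgeSum m f + edgeSum n (λ t → f (m ℕ.+ t))
  edgeSum-split zero    n f = sym (+-identityˡ _)
  edgeSum-split (suc m) n f = ≡.trans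
    (cong (f 0 + f 1 +_) (edgeSum-split m n (λ t → f (suc t))))
    (sym (+-assoc (f 0 + f 1) (edgeSum m (λ t → f (suc t))) (edgeSum n (λ t → f (suc (m ℕ.+ t))))))

  quadratic : ℚ → ℚ → ℚ → ℕ → ℚ
  quadratic α β γ t = α + β * ι t + γ * (ι t * ι t)

  -- Trapezoidal sums: 1, t and t² give 2n, n² and (2n³ + n)/3. The factor 3 clears the last
  -- denominator.
  edgeSum-quadratic : ∀ n α β γ → ι 3 * edgeSum n (quadratic α β γ) ≡
    ι 6 * α * ι n + ι 3 * β * (ι n * ι n) + γ * (ι 2 * (ι n * ι n * ι n) + ι n)
  edgeSum-quadratic zero    α β γ = lemma α β γ
    where
    lemma : ∀ α β γ → ι 3 * 0ℚ ≡ ι 6 * α * ι 0 + ι 3 * β * (ι 0 * ι 0) + γ * (ι 2 * (ι 0 * ι 0 * ι 0) + ι 0)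
    lemma = solve-∀ ring
  edgeSum-quadratic (suc n) α β γ = begin
    ι 3 * (quadratic α β γ 0 + quadratic α β γ 1 + edgeSum n (λ t → quadratic α β γ (suc t)))
      ≡⟨ cong (λ s → ι 3 * (quadratic α β γ 0 + quadratic α β γ 1 + s)) (edgeSum-cong n (λ t _ → shift t)) ⟩
    ι 3 * (quadratic α β γ 0 + quadratic α β γ 1 + S)
      ≡⟨ *-distribˡ-+ (ι 3) (quadratic α β γ 0 + quadratic α β γ 1) S ⟩
    ι 3 * (quadratic α β γ 0 + quadratic α β γ 1) + ι 3 * S
      -- The induction hypothesis is used for the polynomial re-expanded at t + 1, hence the new
      -- coefficients.
      ≡⟨ cong (ι 3 * (quadratic α β γ 0 + quadratic α β γ 1) +_) (edgeSum-quadratic n (α + β + γ) (β + ι 2 * γ) γ) ⟩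
    ι 3 * (quadratic α β γ 0 + quadratic α β γ 1)
    + (ι 6 * (α + β + γ) * ι n + ι 3 * (β + ι 2 * γ) * (ι n * ι n) + γ * (ι 2 * (ι n * ι n * ι n) + ι n))
      ≡⟨ step α β γ (ι n) ⟩
    closed (1ℚ + ι n)
      ≡⟨ cong closed (ι-suc n) ⟨
    closed (ι (suc n)) ∎
    where
    S = edgeSum n (quadratic (α + β + γ) (β + ι 2 * γ) γ)
    closed : ℚ → ℚ
    closed x = ι 6 * α * x + ι 3 * β * (x * x) + γ * (ι 2 * (x * x * x) + x)
    expand : ∀ α β γ t → α + β * (1ℚ + t) + γ * ((1ℚ + t) * (1ℚ + t)) ≡ (α + β + γ) + (β + ι 2 * γ) * t + γ * (t * t)
    expand = solve-∀ ring
    shift : ∀ t → quadratic α β γ (suc t) ≡ quadratic (α + β + γ) (β + ι 2 * γ) γ t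
    shift t = ≡.trans (cong (λ s → α + β * s + γ * (s * s)) (ι-suc t)) (expand α β γ (ι t))
    step : ∀ α β γ x →
      ι 3 * ((α + β * ι 0 + γ * (ι 0 * ι 0)) + (α + β * ι 1 + γ * (ι 1 * ι 1)))
      + (ι 6 * (α + β + γ) * x + ι 3 * (β + ι 2 * γ) * (x * x) + γ * (ι 2 * (x * x * x) + x))
      ≡ ι 6 * α * (1ℚ + x) + ι 3 * β * ((1ℚ + x) * (1ℚ + x)) + γ * (ι 2 * ((1ℚ + x) * (1ℚ + x) * (1ℚ + x)) + (1ℚ + x))
    step = solve-∀ ring

-- Kemeny's constant of the path and of the path with a chord.

module PathKemeny where

  open import Data.Bool using (false)
  open import Data.Fin as F using (Fin; toℕ)
  import Data.Fin.Properties as Fₚ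
  open import Data.Nat as ℕ using (ℕ; suc; ∣_-_∣)
  import Data.Nat.Properties as ℕₚ
  open import Data.Rational hiding (_≟_; floor; ∣_∣)
  open import Data.Rational.Properties hiding (_≟_)
  open import Relation.Binary.PropositionalEquality hiding (trans)
  import Relation.Binary.PropositionalEquality as ≡
  open import Tactic.RingSolver using (solve-∀)
  open Rationals
  open Sums
  open Kemeny
  open EdgeAddition
  open Path
  open ≡-Reasoning

  ∣m+n-m∣≡n : ∀ m n → ∣ m ℕ.+ n - m ∣ ≡ n
  ∣m+n-m∣≡n m n = ≡.trans (ℕₚ.∣-∣-comm (m ℕ.+ n) m) (ℕₚ.∣m-m+n∣≡n m n)

  volume-path : ∀ n → volume (pathAdj (suc n)) ≡ ι 2 * ι n
  volume-path n = *-cancelˡ (ι 3) (begin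
    ι 3 * volume (pathAdj (suc n))
      ≡⟨ cong (ι 3 *_) (≡.trans (volume-degreeSum (pathAdj (suc n))) (degreeSum-path n (λ _ → 1ℚ))) ⟩
    ι 3 * edgeSum n (λ _ → 1ℚ)
      ≡⟨ cong (ι 3 *_) (edgeSum-cong n (λ t _ → constant (ι t))) ⟩
    ι 3 * edgeSum n (quadratic 1ℚ 0ℚ 0ℚ)
      ≡⟨ edgeSum-quadratic n 1ℚ 0ℚ 0ℚ ⟩
    ι 6 * 1ℚ * ι n + ι 3 * 0ℚ * (ι n * ι n) + 0ℚ * (ι 2 * (ι n * ι n * ι n) + ι n)
      ≡⟨ collect (ι n) ⟩
    ι 3 * (ι 2 * ι n) ∎)
    where
    constant : ∀ t → 1ℚ ≡ 1ℚ + 0ℚ * t + 0ℚ * (t * t)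
    constant = solve-∀ ring
    collect : ∀ x → ι 6 * 1ℚ * x + ι 3 * 0ℚ * (x * x) + 0ℚ * (ι 2 * (x * x * x) + x) ≡ ι 3 * (ι 2 * x)
    collect = solve-∀ ring

  pathΓ-diag : ∀ {n} (x : Fin n) → pathΓ x x ≡ 0ℚ
  pathΓ-diag x = cong (λ t → - ι t) (ℕₚ.∣n-n∣≡0 (toℕ x))

  -- This is -(x² + (n - x)²), written by coefficients so that `edgeSum-quadratic` applies.
  pathPotential : ℕ → ℕ → ℚ
  pathPotential n = quadratic (- (ι n * ι n)) (ι 2 * ι n) (- ι 2)

  -- The distance to x is linear on each side of x, and a trapezoidal sum of distances over a side
  -- of length s is s².
  edgeSum-dist : ∀ x r → edgeSum (x ℕ.+ r) (λ t → - ι ∣ x - t ∣) ≡ - (ι x * ι x + ι r * ι r)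
  edgeSum-dist x r = *-cancelˡ (ι 3) (begin
    ι 3 * edgeSum (x ℕ.+ r) (λ t → - ι ∣ x - t ∣)
      ≡⟨ cong (ι 3 *_) (≡.trans (edgeSum-split x r (λ t → - ι ∣ x - t ∣)) (cong₂ _+_
           (edgeSum-cong x (λ t t≤x → ≡.trans (cong -_ (≡.trans (cong ι (ℕₚ.∣-∣-comm x t)) (ι-dist-≤ t≤x))) (left (ι x) (ι t))))
           (edgeSum-cong r (λ t _ → ≡.trans (cong (λ s → - ι s) (ℕₚ.∣m-m+n∣≡n x t)) (right (ι t)))))) ⟩
    ι 3 * (edgeSum x (quadratic (- ι x) 1ℚ 0ℚ) + edgeSum r (quadratic 0ℚ (- 1ℚ) 0ℚ))
      ≡⟨ *-distribˡ-+ (ι 3) (edgeSum x (quadratic (- ι x) 1ℚ 0ℚ)) (edgeSum r (quadratic 0ℚ (- 1ℚ) 0ℚ)) ⟩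
    ι 3 * edgeSum x (quadratic (- ι x) 1ℚ 0ℚ) + ι 3 * edgeSum r (quadratic 0ℚ (- 1ℚ) 0ℚ)
      ≡⟨ cong₂ _+_ (edgeSum-quadratic x (- ι x) 1ℚ 0ℚ) (edgeSum-quadratic r 0ℚ (- 1ℚ) 0ℚ) ⟩
    (ι 6 * - ι x * ι x + ι 3 * 1ℚ * (ι x * ι x) + 0ℚ * (ι 2 * (ι x * ι x * ι x) + ι x))
    + (ι 6 * 0ℚ * ι r + ι 3 * - 1ℚ * (ι r * ι r) + 0ℚ * (ι 2 * (ι r * ι r * ι r) + ι r))
      ≡⟨ collect (ι x) (ι r) ⟩
    ι 3 * - (ι x * ι x + ι r * ι r) ∎)
    where
    left : ∀ x t → - (x - t) ≡ - x + 1ℚ * t + 0ℚ * (t * t)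
    left = solve-∀ ring
    right : ∀ t → - t ≡ 0ℚ + - 1ℚ * t + 0ℚ * (t * t)
    right = solve-∀ ring
    collect : ∀ x r →
      (ι 6 * - x * x + ι 3 * 1ℚ * (x * x) + 0ℚ * (ι 2 * (x * x * x) + x))
      + (ι 6 * 0ℚ * r + ι 3 * - 1ℚ * (r * r) + 0ℚ * (ι 2 * (r * r * r) + r))
      ≡ ι 3 * - (x * x + r * r)
    collect = solve-∀ ring

  degreeSum-pathΓ : ∀ n (x : Fin (suc n)) → degreeSum (pathAdj (suc n)) (pathΓ x) ≡ pathPotential n (toℕ x)
  degreeSum-pathΓ n x = begin
    degreeSum (pathAdj (suc n)) (pathΓ x)
      ≡⟨ degreeSum-path n (λ t → - ι ∣ toℕ x - t ∣) ⟩
    edgeSum n (λ t → - ι ∣ toℕ x - t ∣)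
      ≡⟨ cong (λ m → edgeSum m (λ t → - ι ∣ toℕ x - t ∣)) (ℕₚ.m+[n∸m]≡n x≤n) ⟨
    edgeSum (toℕ x ℕ.+ (n ℕ.∸ toℕ x)) (λ t → - ι ∣ toℕ x - t ∣)
      ≡⟨ edgeSum-dist (toℕ x) (n ℕ.∸ toℕ x) ⟩
    - (ι (toℕ x) * ι (toℕ x) + ι (n ℕ.∸ toℕ x) * ι (n ℕ.∸ toℕ x))
      ≡⟨ cong (λ r → - (ι (toℕ x) * ι (toℕ x) + r * r)) (ι-∸ x≤n) ⟩
    - (ι (toℕ x) * ι (toℕ x) + (ι n - ι (toℕ x)) * (ι n - ι (toℕ x)))
      ≡⟨ expand (ι n) (ι (toℕ x)) ⟩
    pathPotential n (toℕ x) ∎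
    where
    x≤n : toℕ x ℕ.≤ n
    x≤n = ℕ.s≤s⁻¹ (Fₚ.toℕ<n x)
    expand : ∀ n x → - (x * x + (n - x) * (n - x)) ≡ - (n * n) + ι 2 * n * x + - ι 2 * (x * x)
    expand = solve-∀ ring

  degreeSum-pathPotential : ∀ n → ι 3 * degreeSum (pathAdj (suc n)) (λ x → degreeSum (pathAdj (suc n)) (pathΓ x)) ≡
    - (ι 2 * (ι 2 * (ι n * ι n * ι n) + ι n))
  degreeSum-pathPotential n = begin
    ι 3 * degreeSum (pathAdj (suc n)) (λ x → degreeSum (pathAdj (suc n)) (pathΓ x))
      ≡⟨ cong (ι 3 *_) (≡.trans (degreeSum-cong (pathAdj (suc n)) (degreeSum-pathΓ n)) (degreeSum-path n (pathPotential n))) ⟩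
    ι 3 * edgeSum n (pathPotential n)
      ≡⟨ edgeSum-quadratic n (- (ι n * ι n)) (ι 2 * ι n) (- ι 2) ⟩
    ι 6 * - (ι n * ι n) * ι n + ι 3 * (ι 2 * ι n) * (ι n * ι n) + - ι 2 * (ι 2 * (ι n * ι n * ι n) + ι n)
      ≡⟨ collect (ι n) ⟩
    - (ι 2 * (ι 2 * (ι n * ι n * ι n) + ι n)) ∎
    where
    collect : ∀ n → ι 6 * - (n * n) * n + ι 3 * (ι 2 * n) * (n * n) + - ι 2 * (ι 2 * (n * n * n) + n)
                    ≡ - (ι 2 * (ι 2 * (n * n * n) + n))
    collect = solve-∀ ring

  degreeSum-pathΓ-diag : ∀ n → degreeSum (pathAdj (suc n)) (λ x → pathΓ x x) ≡ 0ℚ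
  degreeSum-pathΓ-diag n = ≡.trans
    (sum-cong (suc n) (λ x → ≡.trans (cong (degree (pathAdj (suc n)) x *_) (pathΓ-diag x))
                                     (*-zeroʳ (degree (pathAdj (suc n)) x))))
    (sum-0 (suc n))

  -- That is κ = (2n² + 1)/6 for n edges. The diagonal of `pathΓ` is 0, so only the double sum of
  -- distances contributes.
  kemeny-path : ∀ n → NoIsolated (pathAdj (suc n)) → ∀ {κ} → IsKemeny (pathAdj (suc n)) κ →
    ι 12 * ι n * κ ≡ ι 2 * (ι 2 * (ι n * ι n * ι n) + ι n)
  kemeny-path n nbr {κ} κ-kemeny = begin
    ι 12 * ι n * κ
      ≡⟨ regroup (ι n) κ ⟩
    ι 3 * (ι 2 * (ι 2 * ι n) * κ)
      ≡⟨ cong (λ t → ι 3 * (ι 2 * t * κ)) (volume-path n) ⟨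
    ι 3 * (ι 2 * volume (pathAdj (suc n)) * κ)
      ≡⟨ cong (ι 3 *_) (kemeny-unique (path-sym (suc n)) nbr (path-green n) F.zero κ-kemeny) ⟩
    ι 3 * (volume (pathAdj (suc n)) * degreeSum (pathAdj (suc n)) (λ x → pathΓ x x) - Φ)
      ≡⟨ cong (λ t → ι 3 * (volume (pathAdj (suc n)) * t - Φ)) (degreeSum-pathΓ-diag n) ⟩
    ι 3 * (volume (pathAdj (suc n)) * 0ℚ - Φ)
      ≡⟨ simplify (volume (pathAdj (suc n))) Φ ⟩
    - (ι 3 * Φ)
      ≡⟨ cong -_ (degreeSum-pathPotential n) ⟩
    - - (ι 2 * (ι 2 * (ι n * ι n * ι n) + ι n))
      ≡⟨ involutive (ι 2 * (ι 2 * (ι n * ι n * ι n) + ι n)) ⟩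
    ι 2 * (ι 2 * (ι n * ι n * ι n) + ι n) ∎
    where
    Φ = degreeSum (pathAdj (suc n)) (λ x → degreeSum (pathAdj (suc n)) (pathΓ x))
    regroup : ∀ n k → ι 12 * n * k ≡ ι 3 * (ι 2 * (ι 2 * n) * k)
    regroup = solve-∀ ring
    simplify : ∀ v p → ι 3 * (v * 0ℚ - p) ≡ - (ι 3 * p)
    simplify = solve-∀ ring
    involutive : ∀ x → - - x ≡ x
    involutive = solve-∀ ring

  module _ (a c b : ℕ) where

    private
      n = a ℕ.+ c ℕ.+ b

    -- Constant c and -c on the two tails, where no current flows, and linear with slope -2 between
    -- the ends of the chord. The three lemmas that follow record these pieces.
    pathDipole : ℕ → ℚ
    pathDipole t = 1ℚ * (- ι ∣ t - a ∣) - 1ℚ * (- ι ∣ t - (a ℕ.+ c) ∣)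

    pathDipole-left : ∀ t → t ℕ.≤ a → pathDipole t ≡ ι c
    pathDipole-left t t≤a = begin
      1ℚ * (- ι ∣ t - a ∣) - 1ℚ * (- ι ∣ t - (a ℕ.+ c) ∣)
        ≡⟨ cong₂ (λ x y → 1ℚ * (- x) - 1ℚ * (- y)) (ι-dist-≤ t≤a)
             (≡.trans (ι-dist-≤ (ℕₚ.m≤n⇒m≤n+o c t≤a)) (cong (_- ι t) (ι-+ a c))) ⟩
      1ℚ * (- (ι a - ι t)) - 1ℚ * (- (ι a + ι c - ι t))
        ≡⟨ lemma (ι a) (ι c) (ι t) ⟩
      ι c ∎
      where
      lemma : ∀ a c t → 1ℚ * (- (a - t)) - 1ℚ * (- (a + c - t)) ≡ c
      lemma = solve-∀ ring

    pathDipole-middle : ∀ t → t ℕ.≤ c → pathDipole (a ℕ.+ t) ≡ ι c - ι 2 * ι t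
    pathDipole-middle t t≤c = begin
      1ℚ * (- ι ∣ a ℕ.+ t - a ∣) - 1ℚ * (- ι ∣ a ℕ.+ t - (a ℕ.+ c) ∣)
        ≡⟨ cong₂ (λ x y → 1ℚ * (- ι x) - 1ℚ * (- ι y)) (∣m+n-m∣≡n a t) (ℕₚ.∣m+n-m+o∣≡∣n-o∣ a t c) ⟩
      1ℚ * (- ι t) - 1ℚ * (- ι ∣ t - c ∣)
        ≡⟨ cong (λ y → 1ℚ * (- ι t) - 1ℚ * (- y)) (ι-dist-≤ t≤c) ⟩
      1ℚ * (- ι t) - 1ℚ * (- (ι c - ι t))
        ≡⟨ lemma (ι c) (ι t) ⟩
      ι c - ι 2 * ι t ∎
      where
      lemma : ∀ c t → 1ℚ * (- t) - 1ℚ * (- (c - t)) ≡ c - ι 2 * t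
      lemma = solve-∀ ring

    pathDipole-right : ∀ t → pathDipole (a ℕ.+ c ℕ.+ t) ≡ - ι c
    pathDipole-right t = begin
      1ℚ * (- ι ∣ a ℕ.+ c ℕ.+ t - a ∣) - 1ℚ * (- ι ∣ a ℕ.+ c ℕ.+ t - (a ℕ.+ c) ∣)
        ≡⟨ cong₂ (λ x y → 1ℚ * (- x) - 1ℚ * (- ι y))
             (≡.trans (cong (λ s → ι ∣ s - a ∣) (ℕₚ.+-assoc a c t))
               (≡.trans (cong ι (∣m+n-m∣≡n a (c ℕ.+ t))) (ι-+ c t)))
             (∣m+n-m∣≡n (a ℕ.+ c) t) ⟩
      1ℚ * (- (ι c + ι t)) - 1ℚ * (- ι t)
        ≡⟨ lemma (ι c) (ι t) ⟩
      - ι c ∎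
      where
      lemma : ∀ c t → 1ℚ * (- (c + t)) - 1ℚ * (- t) ≡ - c
      lemma = solve-∀ ring

    edgeSum-pathDipole² : ι 3 * edgeSum n (λ t → pathDipole t * pathDipole t) ≡
      ι 6 * (ι a + ι b) * (ι c * ι c) + ι 2 * (ι c * ι c * ι c) + ι 4 * ι c
    edgeSum-pathDipole² = begin
      ι 3 * edgeSum n square
        ≡⟨ cong (ι 3 *_) (≡.trans (edgeSum-split (a ℕ.+ c) b square)
             (cong (_+ edgeSum b (λ t → square (a ℕ.+ c ℕ.+ t))) (edgeSum-split a c square))) ⟩
      ι 3 * (edgeSum a square + edgeSum c (λ t → square (a ℕ.+ t)) + edgeSum b (λ t → square (a ℕ.+ c ℕ.+ t)))
        ≡⟨ cong (ι 3 *_) (cong₂ _+_ (cong₂ _+_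
             (edgeSum-cong a (λ t t≤a → ≡.trans (cong (λ x → x * x) (pathDipole-left t t≤a)) (left (ι c) (ι t))))
             (edgeSum-cong c (λ t t≤c → ≡.trans (cong (λ x → x * x) (pathDipole-middle t t≤c)) (middle (ι c) (ι t)))))
             (edgeSum-cong b (λ t _ → ≡.trans (cong (λ x → x * x) (pathDipole-right t)) (right (ι c) (ι t))))) ⟩
      ι 3 * (edgeSum a q₁ + edgeSum c q₂ + edgeSum b q₁)
        ≡⟨ distribute (edgeSum a q₁) (edgeSum c q₂) (edgeSum b q₁) ⟩
      ι 3 * edgeSum a q₁ + ι 3 * edgeSum c q₂ + ι 3 * edgeSum b q₁
        ≡⟨ cong₂ _+_ (cong₂ _+_ (edgeSum-quadratic a (ι c * ι c) 0ℚ 0ℚ)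
                                (edgeSum-quadratic c (ι c * ι c) (- (ι 4 * ι c)) (ι 4)))
                     (edgeSum-quadratic b (ι c * ι c) 0ℚ 0ℚ) ⟩
      (ι 6 * (ι c * ι c) * ι a + ι 3 * 0ℚ * (ι a * ι a) + 0ℚ * (ι 2 * (ι a * ι a * ι a) + ι a))
      + (ι 6 * (ι c * ι c) * ι c + ι 3 * (- (ι 4 * ι c)) * (ι c * ι c) + ι 4 * (ι 2 * (ι c * ι c * ι c) + ι c))
      + (ι 6 * (ι c * ι c) * ι b + ι 3 * 0ℚ * (ι b * ι b) + 0ℚ * (ι 2 * (ι b * ι b * ι b) + ι b))
        ≡⟨ collect (ι a) (ι b) (ι c) ⟩
      ι 6 * (ι a + ι b) * (ι c * ι c) + ι 2 * (ι c * ι c * ι c) + ι 4 * ι c ∎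
      where
      square q₁ q₂ : ℕ → ℚ
      square t = pathDipole t * pathDipole t
      q₁ = quadratic (ι c * ι c) 0ℚ 0ℚ
      q₂ = quadratic (ι c * ι c) (- (ι 4 * ι c)) (ι 4)
      left : ∀ c t → c * c ≡ c * c + 0ℚ * t + 0ℚ * (t * t)
      left = solve-∀ ring
      middle : ∀ c t → (c - ι 2 * t) * (c - ι 2 * t) ≡ c * c + - (ι 4 * c) * t + ι 4 * (t * t)
      middle = solve-∀ ring
      right : ∀ c t → - c * - c ≡ c * c + 0ℚ * t + 0ℚ * (t * t)
      right = solve-∀ ring
      distribute : ∀ x y z → ι 3 * (x + y + z) ≡ ι 3 * x + ι 3 * y + ι 3 * z
      distribute = solve-∀ ring
      collect : ∀ a b c →
        (ι 6 * (c * c) * a + ι 3 * 0ℚ * (a * a) + 0ℚ * (ι 2 * (a * a * a) + a))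
        + (ι 6 * (c * c) * c + ι 3 * (- (ι 4 * c)) * (c * c) + ι 4 * (ι 2 * (c * c * c) + c))
        + (ι 6 * (c * c) * b + ι 3 * 0ℚ * (b * b) + 0ℚ * (ι 2 * (b * b * b) + b))
        ≡ ι 6 * (a + b) * (c * c) + ι 2 * (c * c * c) + ι 4 * c
      collect = solve-∀ ring

    module _ {u v : Fin (suc n)} (u≡a : toℕ u ≡ a) (v≡a+c : toℕ v ≡ a ℕ.+ c)
             (u≢v : u ≢ v) (Auv : pathAdj (suc n) u v ≡ false) (nbr : NoIsolated (pathAdj (suc n))) where

      private
        P  = pathAdj (suc n)
        P⁺ = addEdge P u v
        P-sym = path-sym (suc n)
        nbr⁺ = addEdge-noIsolated {A = P} nbr u v
        g = dipole P-sym u≢v Auv nbr (path-green n)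
        ρ = resistance P-sym u≢v Auv nbr (path-green n)
        α = ι a
        β = ι b
        γ = ι c
        N = α + γ + β

      cycleGreen : IsGreen P⁺ ((ι 2 + ρ) * ι 2) (λ x → (ι 2 + ρ) * endpoints x)
                     (Γ⁺ P-sym u≢v Auv nbr (path-green n))
      cycleGreen = green-addEdge P-sym u≢v Auv nbr (path-green n)

      dipole-path : ∀ x → g x ≡ pathDipole (toℕ x)
      dipole-path x = cong₂ (λ s t → 1ℚ * (- ι ∣ toℕ x - s ∣) - 1ℚ * (- ι ∣ toℕ x - t ∣)) u≡a v≡a+c

      dipole-u : g u ≡ γ
      dipole-u = ≡.trans (dipole-path u) (pathDipole-left (toℕ u) (ℕₚ.≤-reflexive u≡a))

      dipole-v : g v ≡ - γ
      dipole-v = ≡.trans (dipole-path v)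
        (≡.trans (cong pathDipole (≡.trans v≡a+c (sym (ℕₚ.+-identityʳ (a ℕ.+ c))))) (pathDipole-right 0))

      resistance-path : ρ ≡ ι 2 * γ
      resistance-path = ≡.trans (cong₂ _-_ dipole-u dipole-v) (lemma γ)
        where
        lemma : ∀ c → c - - c ≡ ι 2 * c
        lemma = solve-∀ ring

      ι-n : ι n ≡ N
      ι-n = ≡.trans (ι-+ (a ℕ.+ c) b) (cong (_+ β) (ι-+ a c))

      volume-cycle : volume P⁺ ≡ ι 2 * N + ι 2
      volume-cycle = ≡.trans (volume-addEdge P-sym u≢v Auv)
        (cong (_+ ι 2) (≡.trans (volume-path n) (cong (ι 2 *_) ι-n)))

      -- The factor on the left is 3 σ⁺ vol⁺, with σ⁺ = (2 + 2c) 2 and vol⁺ = 2N + 2; the 3 clears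
      -- the sums of squares.
      kemeny-cycle : ∀ {κ} → IsKemeny P⁺ κ → ι 24 * (γ + 1ℚ) * (N + 1ℚ) * κ ≡
        - ((ι 2 * N + ι 2) * (ι 6 * (α + β) * (γ * γ) + ι 2 * (γ * γ * γ) + ι 4 * γ + ι 6 * (γ * γ)))
        + (ι 2 + ι 2 * γ) * (ι 2 * (ι 2 * (N * N * N) + N)
                             + ι 6 * (α * α + (γ + β) * (γ + β) + (α + γ) * (α + γ) + β * β) + ι 6 * γ)
        + ι 12 * (γ * γ * ((α - β) * (α - β)))
      kemeny-cycle {κ} κ-kemeny = begin
        ι 24 * (γ + 1ℚ) * (N + 1ℚ) * κ
          ≡⟨ regroup γ N κ ⟩
        ι 3 * ((ι 2 + ι 2 * γ) * ι 2 * (ι 2 * N + ι 2) * κ)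
          ≡⟨ cong₂ (λ r w → ι 3 * ((ι 2 + r) * ι 2 * w * κ)) resistance-path volume-cycle ⟨
        ι 3 * ((ι 2 + ρ) * ι 2 * volume P⁺ * κ)
          ≡⟨ cong (ι 3 *_) (≡.trans (kemeny-unique (addEdge-sym {A = P} P-sym u v) nbr⁺ cycleGreen F.zero κ-kemeny)
               (kemenyNumerator-addEdge P-sym u≢v Auv nbr (path-green n))) ⟩
        ι 3 * numerator (volume P) ρ (degreeSum P (λ x → pathΓ x x)) (pathΓ u u) (pathΓ v v) (pathΓ u v)
                D² (g u) (g v) Φ (degreeSum P (pathΓ u)) (degreeSum P (pathΓ v))
          ≡⟨ cong (ι 3 *_) evaluate ⟩
        ι 3 * numerator (ι 2 * N) (ι 2 * γ) 0ℚ 0ℚ 0ℚ (- γ) D² γ (- γ) Φ φu φv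
          ≡⟨ clear N γ D² Φ φu φv ⟩
        closed (ι 3 * D²) (ι 3 * Φ)
          ≡⟨ cong₂ closed sum-D² sum-Φ ⟩
        closed (ι 6 * (α + β) * (γ * γ) + ι 2 * (γ * γ * γ) + ι 4 * γ) (- (ι 2 * (ι 2 * (N * N * N) + N)))
          ≡⟨ expand α β γ ⟩
        - ((ι 2 * N + ι 2) * (ι 6 * (α + β) * (γ * γ) + ι 2 * (γ * γ * γ) + ι 4 * γ + ι 6 * (γ * γ)))
        + (ι 2 + ι 2 * γ) * (ι 2 * (ι 2 * (N * N * N) + N)
                             + ι 6 * (α * α + (γ + β) * (γ + β) + (α + γ) * (α + γ) + β * β) + ι 6 * γ)
        + ι 12 * (γ * γ * ((α - β) * (α - β))) ∎
        where
        D² = degreeSum P (λ x → g x * g x)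
        Φ = degreeSum P (λ x → degreeSum P (pathΓ x))
        φu = - (N * N) + ι 2 * N * α + - ι 2 * (α * α)
        φv = - (N * N) + ι 2 * N * (α + γ) + - ι 2 * ((α + γ) * (α + γ))

        -- The formula of `kemenyNumerator-addEdge` with every entry made a variable, so that values
        -- can be substituted two at a time.
        numerator : (V r T Tu Tv Tuv D gu gv Q qu qv : ℚ) → ℚ
        numerator V r T Tu Tv Tuv D gu gv Q qu qv =
          (V + ι 2) * ((ι 2 + r) * (T + (Tu + Tv)) - (D + (gu * gu + gv * gv)))
          - ((ι 2 + r) * (Q + ι 2 * (qu + qv) + (Tu + ι 2 * Tuv + Tv))
             - (qu - qv + (gu + gv)) * (qu - qv + (gu + gv)))

        closed : ℚ → ℚ → ℚ
        closed D Q =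
          - ((ι 2 * N + ι 2) * (D + ι 6 * (γ * γ)))
          - (ι 2 + ι 2 * γ) * (Q + ι 6 * (φu + φv) - ι 6 * γ)
          + ι 3 * ((φu - φv) * (φu - φv))

        potential-at : ∀ x s → ι (toℕ x) ≡ s → degreeSum P (pathΓ x) ≡ - (N * N) + ι 2 * N * s + - ι 2 * (s * s)
        potential-at x s eq = ≡.trans (degreeSum-pathΓ n x)
          (cong₂ (λ m t → - (m * m) + ι 2 * m * t + - ι 2 * (t * t)) ι-n eq)

        pathΓ-uv : pathΓ u v ≡ - γ
        pathΓ-uv = cong (λ t → - ι t) (≡.trans (cong₂ ∣_-_∣ u≡a v≡a+c) (ℕₚ.∣m-m+n∣≡n a c))

        evaluate : numerator (volume P) ρ (degreeSum P (λ x → pathΓ x x)) (pathΓ u u) (pathΓ v v) (pathΓ u v)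
                     D² (g u) (g v) Φ (degreeSum P (pathΓ u)) (degreeSum P (pathΓ v))
                   ≡ numerator (ι 2 * N) (ι 2 * γ) 0ℚ 0ℚ 0ℚ (- γ) D² γ (- γ) Φ φu φv
        evaluate = begin
          numerator (volume P) ρ (degreeSum P (λ x → pathΓ x x)) (pathΓ u u) (pathΓ v v) (pathΓ u v)
            D² (g u) (g v) Φ (degreeSum P (pathΓ u)) (degreeSum P (pathΓ v))
            ≡⟨ cong₂ (λ V r → numerator V r (degreeSum P (λ x → pathΓ x x)) (pathΓ u u) (pathΓ v v) (pathΓ u v)
                 D² (g u) (g v) Φ (degreeSum P (pathΓ u)) (degreeSum P (pathΓ v)))
                 (≡.trans (volume-path n) (cong (ι 2 *_) ι-n)) resistance-path ⟩
          numerator (ι 2 * N) (ι 2 * γ) (degreeSum P (λ x → pathΓ x x)) (pathΓ u u) (pathΓ v v) (pathΓ u v)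
            D² (g u) (g v) Φ (degreeSum P (pathΓ u)) (degreeSum P (pathΓ v))
            ≡⟨ cong₂ (λ T Tu → numerator (ι 2 * N) (ι 2 * γ) T Tu (pathΓ v v) (pathΓ u v)
                 D² (g u) (g v) Φ (degreeSum P (pathΓ u)) (degreeSum P (pathΓ v)))
                 (degreeSum-pathΓ-diag n) (pathΓ-diag u) ⟩
          numerator (ι 2 * N) (ι 2 * γ) 0ℚ 0ℚ (pathΓ v v) (pathΓ u v)
            D² (g u) (g v) Φ (degreeSum P (pathΓ u)) (degreeSum P (pathΓ v))
            ≡⟨ cong₂ (λ Tv Tuv → numerator (ι 2 * N) (ι 2 * γ) 0ℚ 0ℚ Tv Tuv
                 D² (g u) (g v) Φ (degreeSum P (pathΓ u)) (degreeSum P (pathΓ v)))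
                 (pathΓ-diag v) pathΓ-uv ⟩
          numerator (ι 2 * N) (ι 2 * γ) 0ℚ 0ℚ 0ℚ (- γ)
            D² (g u) (g v) Φ (degreeSum P (pathΓ u)) (degreeSum P (pathΓ v))
            ≡⟨ cong₂ (λ gu gv → numerator (ι 2 * N) (ι 2 * γ) 0ℚ 0ℚ 0ℚ (- γ)
                 D² gu gv Φ (degreeSum P (pathΓ u)) (degreeSum P (pathΓ v))) dipole-u dipole-v ⟩
          numerator (ι 2 * N) (ι 2 * γ) 0ℚ 0ℚ 0ℚ (- γ)
            D² γ (- γ) Φ (degreeSum P (pathΓ u)) (degreeSum P (pathΓ v))
            ≡⟨ cong₂ (λ qu qv → numerator (ι 2 * N) (ι 2 * γ) 0ℚ 0ℚ 0ℚ (- γ) D² γ (- γ) Φ qu qv)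
                 (potential-at u α (cong ι u≡a)) (potential-at v (α + γ) (≡.trans (cong ι v≡a+c) (ι-+ a c))) ⟩
          numerator (ι 2 * N) (ι 2 * γ) 0ℚ 0ℚ 0ℚ (- γ) D² γ (- γ) Φ φu φv ∎

        sum-D² : ι 3 * D² ≡ ι 6 * (α + β) * (γ * γ) + ι 2 * (γ * γ * γ) + ι 4 * γ
        sum-D² = ≡.trans
          (cong (ι 3 *_) (≡.trans (degreeSum-cong P (λ x → cong (λ t → t * t) (dipole-path x)))
                                  (degreeSum-path n (λ t → pathDipole t * pathDipole t))))
          edgeSum-pathDipole²

        sum-Φ : ι 3 * Φ ≡ - (ι 2 * (ι 2 * (N * N * N) + N))
        sum-Φ = ≡.trans (degreeSum-pathPotential n) (cong (λ m → - (ι 2 * (ι 2 * (m * m * m) + m))) ι-n)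

        regroup : ∀ c n k → ι 24 * (c + 1ℚ) * (n + 1ℚ) * k ≡ ι 3 * ((ι 2 + ι 2 * c) * ι 2 * (ι 2 * n + ι 2) * k)
        regroup = solve-∀ ring

        clear : ∀ n c D Q p r →
          ι 3 * ((ι 2 * n + ι 2) * ((ι 2 + ι 2 * c) * (0ℚ + (0ℚ + 0ℚ)) - (D + (c * c + (- c) * (- c))))
                 - ((ι 2 + ι 2 * c) * (Q + ι 2 * (p + r) + (0ℚ + ι 2 * (- c) + 0ℚ))
                    - (p - r + (c + (- c))) * (p - r + (c + (- c)))))
          ≡ - ((ι 2 * n + ι 2) * (ι 3 * D + ι 6 * (c * c)))
            - (ι 2 + ι 2 * c) * (ι 3 * Q + ι 6 * (p + r) - ι 6 * c)
            + ι 3 * ((p - r) * (p - r))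
        clear = solve-∀ ring

        -- The potentials at u and v enter only through their sum and the square of their
        -- difference. Both are simplified first, so that `assemble` can treat the results as atoms.
        u+v : ∀ a b c →
          let n = a + c + b
              p = - (n * n) + ι 2 * n * a + - ι 2 * (a * a)
              r = - (n * n) + ι 2 * n * (a + c) + - ι 2 * ((a + c) * (a + c))
          in p + r ≡ - (a * a + (c + b) * (c + b) + (a + c) * (a + c) + b * b)
        u+v = solve-∀ ring

        u-v : ∀ a b c →
          let n = a + c + b
              p = - (n * n) + ι 2 * n * a + - ι 2 * (a * a)
              r = - (n * n) + ι 2 * n * (a + c) + - ι 2 * ((a + c) * (a + c))
          in p - r ≡ ι 2 * (c * (a - b))
        u-v = solve-∀ ring

        assemble : ∀ n c D Q s t →
          - ((ι 2 * n + ι 2) * D) - (ι 2 + ι 2 * c) * (- Q + ι 6 * (- s) - ι 6 * c) + ι 3 * (ι 2 * (c * t) * (ι 2 * (c * t)))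
          ≡ - ((ι 2 * n + ι 2) * D) + (ι 2 + ι 2 * c) * (Q + ι 6 * s + ι 6 * c) + ι 12 * (c * c * (t * t))
        assemble = solve-∀ ring

        expand : ∀ a b c →
          let n = a + c + b
              p = - (n * n) + ι 2 * n * a + - ι 2 * (a * a)
              r = - (n * n) + ι 2 * n * (a + c) + - ι 2 * ((a + c) * (a + c))
          in
          - ((ι 2 * n + ι 2) * (ι 6 * (a + b) * (c * c) + ι 2 * (c * c * c) + ι 4 * c + ι 6 * (c * c)))
          - (ι 2 + ι 2 * c) * (- (ι 2 * (ι 2 * (n * n * n) + n)) + ι 6 * (p + r) - ι 6 * c)
          + ι 3 * ((p - r) * (p - r))
          ≡ - ((ι 2 * n + ι 2) * (ι 6 * (a + b) * (c * c) + ι 2 * (c * c * c) + ι 4 * c + ι 6 * (c * c)))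
            + (ι 2 + ι 2 * c) * (ι 2 * (ι 2 * (n * n * n) + n)
                + ι 6 * (a * a + (c + b) * (c + b) + (a + c) * (a + c) + b * b) + ι 6 * c)
            + ι 12 * (c * c * ((a - b) * (a - b)))
        expand a b c = ≡.trans
          (cong₂ (λ s d → - ((ι 2 * x + ι 2) * D) - (ι 2 + ι 2 * c) * (- Q + ι 6 * s - ι 6 * c) + ι 3 * (d * d))
            (u+v a b c) (u-v a b c))
          (assemble x c D Q (a * a + (c + b) * (c + b) + (a + c) * (a + c) + b * b) (a - b))
          where
          x = a + c + b
          D = ι 6 * (a + b) * (c * c) + ι 2 * (c * c * c) + ι 4 * c + ι 6 * (c * c)
          Q = ι 2 * (ι 2 * (x * x * x) + x)

-- Comparing the two constants, and passage from rationals to naturals.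

module Comparison where

  open import Data.Bool using (false)
  open import Data.Fin using (Fin; toℕ)
  import Data.Integer as ℤ
  open import Data.Nat as ℕ using (ℕ; suc)
  import Data.Nat.Properties as ℕₚ
  open import Data.Product using (∃)
  open import Data.Rational hiding (_≟_; floor; ∣_∣)
  open import Data.Rational.Properties hiding (_≟_)
  open import Function.Bundles using (_⇔_; mk⇔)
  open import Function.Construct.Composition using (_⇔-∘_)
  open import Relation.Binary.PropositionalEquality hiding (trans)
  import Relation.Binary.PropositionalEquality as ≡
  open import Tactic.RingSolver using (solve-∀)
  open Rationals
  open Kemeny
  open EdgeAddition
  open Path
  open PathKemeny

  -- Syntax of polynomials with natural coefficients: one expression is read in ℕ for inequalities
  -- and in ℚ for identities, and a single lemma links the readings.
  data Term : Set where
    #_      : ℕ → Term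
    _⊕_ _⊗_ : Term → Term → Term

  infix  8 #_
  infixl 7 _⊗_
  infixl 6 _⊕_

  ⟦_⟧ℕ : Term → ℕ
  ⟦ # n ⟧ℕ   = n
  ⟦ s ⊕ t ⟧ℕ = ⟦ s ⟧ℕ ℕ.+ ⟦ t ⟧ℕ
  ⟦ s ⊗ t ⟧ℕ = ⟦ s ⟧ℕ ℕ.* ⟦ t ⟧ℕ

  ⟦_⟧ℚ : Term → ℚ
  ⟦ # n ⟧ℚ   = ι n
  ⟦ s ⊕ t ⟧ℚ = ⟦ s ⟧ℚ + ⟦ t ⟧ℚ
  ⟦ s ⊗ t ⟧ℚ = ⟦ s ⟧ℚ * ⟦ t ⟧ℚ

  ι-⟦⟧ : ∀ t → ι ⟦ t ⟧ℕ ≡ ⟦ t ⟧ℚ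
  ι-⟦⟧ (# n)   = refl
  ι-⟦⟧ (s ⊕ t) = ≡.trans (ι-+ ⟦ s ⟧ℕ ⟦ t ⟧ℕ) (cong₂ _+_ (ι-⟦⟧ s) (ι-⟦⟧ t))
  ι-⟦⟧ (s ⊗ t) = ≡.trans (ι-* ⟦ s ⟧ℕ ⟦ t ⟧ℕ) (cong₂ _*_ (ι-⟦⟧ s) (ι-⟦⟧ t))

  +-cancelˡ-< : ∀ x y z → x + y < x + z → y < z
  +-cancelˡ-< x y z lt = subst₂ _<_ (lemma x y) (lemma x z) (+-monoʳ-< (- x) lt)
    where
    lemma : ∀ x y → - x + (x + y) ≡ y
    lemma = solve-∀ ring

  -- The hypothesis is M (y - x) = F (t - s) with the negative terms moved across, so both
  -- differences have the same sign.
  <-balance : ∀ M F .{{_ : Positive M}} .{{_ : Positive F}} {x y s t} → M * y + F * s ≡ M * x + F * t → x < y ⇔ s < t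
  <-balance M F {x} {y} {s} {t} eq = mk⇔ to from
    where
    instance
      M≥0 : NonNegative M
      M≥0 = pos⇒nonNeg M
      F≥0 : NonNegative F
      F≥0 = pos⇒nonNeg F
    to : x < y → s < t
    to x<y = *-cancelˡ-<-nonNeg F (+-cancelˡ-< (M * x) (F * s) (F * t)
      (subst (M * x + F * s <_) eq (+-monoˡ-< (F * s) (*-monoʳ-<-pos M x<y))))
    from : s < t → x < y
    from s<t = *-cancelˡ-<-nonNeg M (+-cancelˡ-< (F * s) (M * x) (M * y)
      (subst₂ _<_ (+-comm (M * x) (F * s)) (≡.trans (sym eq) (+-comm (M * y) (F * s)))
        (+-monoʳ-< (M * x) (*-monoʳ-<-pos F s<t))))

  ι-⇔ : ∀ {m n} → ι m < ι n ⇔ m ℕ.< n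
  ι-⇔ {m} {n} = mk⇔ (ι-cancel-< {m} {n}) (ι-mono-< {m} {n})

  -- Multiplication by 16 clears 3/4 and 7/16, and moving 12 l to the right avoids subtraction in ℕ.
  threshold⇔ : ∀ k l → (ι (l ℕ.* l) - (ℤ.+ 3 / 4) * ι l + (ℤ.+ 7 / 16) < ι k) ⇔ 16 ℕ.* (l ℕ.* l) ℕ.+ 7 ℕ.< 16 ℕ.* k ℕ.+ 12 ℕ.* l
  threshold⇔ k l = ι-⇔ {16 ℕ.* (l ℕ.* l) ℕ.+ 7} {16 ℕ.* k ℕ.+ 12 ℕ.* l} ⇔-∘ <-balance (ι 16) 1ℚ (begin
    ι 16 * ι k + 1ℚ * ι (16 ℕ.* (l ℕ.* l) ℕ.+ 7)
      ≡⟨ cong (λ t → ι 16 * ι k + 1ℚ * t) (ι-⟦⟧ (# 16 ⊗ # (l ℕ.* l) ⊕ # 7)) ⟩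
    ι 16 * ι k + 1ℚ * (ι 16 * ι (l ℕ.* l) + ι 7)
      ≡⟨ lemma (ι k) (ι l) (ι (l ℕ.* l)) ⟩
    ι 16 * (ι (l ℕ.* l) - (ℤ.+ 3 / 4) * ι l + (ℤ.+ 7 / 16)) + 1ℚ * (ι 16 * ι k + ι 12 * ι l)
      ≡⟨ cong (λ t → ι 16 * (ι (l ℕ.* l) - (ℤ.+ 3 / 4) * ι l + (ℤ.+ 7 / 16)) + 1ℚ * t) (ι-⟦⟧ (# 16 ⊗ # k ⊕ # 12 ⊗ # l)) ⟨
    ι 16 * (ι (l ℕ.* l) - (ℤ.+ 3 / 4) * ι l + (ℤ.+ 7 / 16)) + 1ℚ * ι (16 ℕ.* k ℕ.+ 12 ℕ.* l) ∎)
    where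
    open ≡-Reasoning
    lemma : ∀ k l m → ι 16 * k + 1ℚ * (ι 16 * m + ι 7) ≡
                      ι 16 * (m - (ℤ.+ 3 / 4) * l + (ℤ.+ 7 / 16)) + 1ℚ * (ι 16 * k + ι 12 * l)
    lemma = solve-∀ ring

  -- With c = e + 1, l = e + 2 and N = a + c + b one has 6 l (N + 1) (κ′ − κ) = gain − loss.
  gain loss : (a e b : ℕ) → Term
  gain a e b = (# e ⊕ # 2) ⊗ (# 4 ⊗ ((# a ⊕ # b) ⊗ (# a ⊕ # b)))
  loss a e b = (# e ⊕ # 2) ⊗ (# 4 ⊗ ((# e ⊕ # 1) ⊗ (# e ⊕ # 1)) ⊗ (# a ⊕ # b) ⊕ # e ⊗ # e ⊗ (# e ⊕ # 2))
               ⊕ # 12 ⊗ ((# e ⊕ # 2 ⊕ (# e ⊕ # 1) ⊗ (# e ⊕ # 1)) ⊗ (# a ⊗ # b))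

  -- Writing c = e + 1 makes (c - 1)² the natural square e². The constants are arbitrary witnesses,
  -- evaluated by `kemeny-path` and `kemeny-cycle`.
  kemeny-comparison : ∀ a e b {u v : Fin (suc (a ℕ.+ suc e ℕ.+ b))} →
    toℕ u ≡ a → toℕ v ≡ a ℕ.+ suc e → u ≢ v → pathAdj (suc (a ℕ.+ suc e ℕ.+ b)) u v ≡ false →
    NoIsolated (pathAdj (suc (a ℕ.+ suc e ℕ.+ b))) →
    ∀ {κ κ′} → IsKemeny (pathAdj (suc (a ℕ.+ suc e ℕ.+ b))) κ →
    IsKemeny (addEdge (pathAdj (suc (a ℕ.+ suc e ℕ.+ b))) u v) κ′ →
    κ < κ′ ⇔ ⟦ loss a e b ⟧ℕ ℕ.< ⟦ gain a e b ⟧ℕ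
  kemeny-comparison a e b {u} {v} u≡a v≡a+c u≢v Auv nbr {κ} {κ′} κ-path κ′-cycle =
    ι-⇔ {⟦ loss a e b ⟧ℕ} {⟦ gain a e b ⟧ℕ} ⇔-∘ <-balance M F {{M>0}} {{F>0}} (begin
      M * κ′ + F * ι ⟦ loss a e b ⟧ℕ
        ≡⟨ cong (λ t → M * κ′ + F * t) (ι-⟦⟧ (loss a e b)) ⟩
      M * κ′ + F * ⟦ loss a e b ⟧ℚ
        ≡⟨ cong (_+ F * ⟦ loss a e b ⟧ℚ) cycle ⟩
      N * Q α β (1ℚ + ε) + F * ⟦ loss a e b ⟧ℚ
        ≡⟨ balance α β ε ⟩
      ι 2 * (ε + ι 2) * (N + 1ℚ) * (ι 2 * (ι 2 * (N * N * N) + N)) + F * ⟦ gain a e b ⟧ℚ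
        ≡⟨ cong₂ _+_ path (cong (F *_) (ι-⟦⟧ (gain a e b))) ⟨
      M * κ + F * ι ⟦ gain a e b ⟧ℕ ∎)
    where
    open ≡-Reasoning
    n = a ℕ.+ suc e ℕ.+ b
    α = ι a
    β = ι b
    ε = ι e
    N = α + (1ℚ + ε) + β
    -- A common multiple of the factors 12 N and 24 l (N + 1) in the two evaluations. Since M is 4N
    -- times 6 l (N + 1), the difference gain - loss acquires the factor F = 4N.
    M = ι 24 * (ε + ι 2) * (N + 1ℚ) * N
    F = ι 4 * N

    Q : ℚ → ℚ → ℚ → ℚ
    Q α β γ = let N = α + γ + β in
      - ((ι 2 * N + ι 2) * (ι 6 * (α + β) * (γ * γ) + ι 2 * (γ * γ * γ) + ι 4 * γ + ι 6 * (γ * γ)))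
      + (ι 2 + ι 2 * γ) * (ι 2 * (ι 2 * (N * N * N) + N)
                           + ι 6 * (α * α + (γ + β) * (γ + β) + (α + γ) * (α + γ) + β * β) + ι 6 * γ)
      + ι 12 * (γ * γ * ((α - β) * (α - β)))

    N>0 : Positive N
    N>0 = subst Positive
      (ι-⟦⟧ (# a ⊕ (# 1 ⊕ # e) ⊕ # b))
      (ι-pos n {{ℕ.>-nonZero (ℕₚ.<-≤-trans (ℕₚ.<-≤-trans ℕ.z<s (ℕₚ.m≤n+m (suc e) a)) (ℕₚ.m≤m+n (a ℕ.+ suc e) b))}})

    F>0 : Positive F
    F>0 = pos*pos⇒pos (ι 4) N {{N>0}}

    l>0 : Positive (ε + ι 2)
    l>0 = subst Positive (ι-⟦⟧ (# e ⊕ # 2)) (ι-pos (e ℕ.+ 2) {{ℕ.>-nonZero (ℕₚ.<-≤-trans ℕ.z<s (ℕₚ.m≤n+m 2 e))}})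

    24l>0 : Positive (ι 24 * (ε + ι 2))
    24l>0 = pos*pos⇒pos (ι 24) (ε + ι 2) {{l>0}}

    24l[N+1]>0 : Positive (ι 24 * (ε + ι 2) * (N + 1ℚ))
    24l[N+1]>0 = pos*pos⇒pos (ι 24 * (ε + ι 2)) {{24l>0}} (N + 1ℚ) {{pos+pos⇒pos N {{N>0}} 1ℚ}}

    M>0 : Positive M
    M>0 = pos*pos⇒pos (ι 24 * (ε + ι 2) * (N + 1ℚ)) {{24l[N+1]>0}} N {{N>0}}

    cycle : M * κ′ ≡ N * Q α β (1ℚ + ε)
    cycle = ≡.trans (regroup (1ℚ + ε) (ε + ι 2) N κ′ (shift ε)) (cong (N *_)
      (subst (λ γ → ι 24 * (γ + 1ℚ) * (α + γ + β + 1ℚ) * κ′ ≡ Q α β γ) (ι-suc e)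
        (kemeny-cycle a (suc e) b u≡a v≡a+c u≢v Auv nbr κ′-cycle)))
      where
      shift : ∀ x → x + ι 2 ≡ (1ℚ + x) + 1ℚ
      shift = solve-∀ ring
      swap : ∀ c n k → ι 24 * (c + 1ℚ) * (n + 1ℚ) * n * k ≡ n * (ι 24 * (c + 1ℚ) * (n + 1ℚ) * k)
      swap = solve-∀ ring
      regroup : ∀ c l n k → l ≡ c + 1ℚ → ι 24 * l * (n + 1ℚ) * n * k ≡ n * (ι 24 * (c + 1ℚ) * (n + 1ℚ) * k)
      regroup c l n k refl = swap c n k

    path : M * κ ≡ ι 2 * (ε + ι 2) * (N + 1ℚ) * (ι 2 * (ι 2 * (N * N * N) + N))
    path = ≡.trans (regroup (ε + ι 2) N κ) (cong (ι 2 * (ε + ι 2) * (N + 1ℚ) *_)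
      (subst (λ N → ι 12 * N * κ ≡ ι 2 * (ι 2 * (N * N * N) + N)) (ι-⟦⟧ (# a ⊕ (# 1 ⊕ # e) ⊕ # b))
        (kemeny-path n nbr κ-path)))
      where
      regroup : ∀ l n k → ι 24 * l * (n + 1ℚ) * n * k ≡ ι 2 * l * (n + 1ℚ) * (ι 12 * n * k)
      regroup = solve-∀ ring

    balance : ∀ a b e → let c = 1ℚ + e ; n = a + c + b in
      n * (- ((ι 2 * n + ι 2) * (ι 6 * (a + b) * (c * c) + ι 2 * (c * c * c) + ι 4 * c + ι 6 * (c * c)))
           + (ι 2 + ι 2 * c) * (ι 2 * (ι 2 * (n * n * n) + n)
                               + ι 6 * (a * a + (c + b) * (c + b) + (a + c) * (a + c) + b * b) + ι 6 * c)
           + ι 12 * (c * c * ((a - b) * (a - b))))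
      + ι 4 * n * ((e + ι 2) * (ι 4 * ((e + ι 1) * (e + ι 1)) * (a + b) + e * e * (e + ι 2))
                   + ι 12 * ((e + ι 2 + (e + ι 1) * (e + ι 1)) * (a * b)))
      ≡ ι 2 * (e + ι 2) * (n + 1ℚ) * (ι 2 * (ι 2 * (n * n * n) + n))
        + ι 4 * n * ((e + ι 2) * (ι 4 * ((a + b) * (a + b))))
    balance = solve-∀ ring

  kemeny-path-exists : ∀ n .{{_ : ℕ.NonZero n}} → NoIsolated (pathAdj (suc n)) → ∃ (IsKemeny (pathAdj (suc n)))
  kemeny-path-exists n nbr = kemeny-exists (path-sym (suc n)) nbr (path-green n)
    {{_}} {{subst Positive (sym (volume-path n)) (pos*pos⇒pos (ι 2) (ι n) {{ι-pos n}})}}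

  kemeny-cycle-exists : ∀ a c b {u v : Fin (suc (a ℕ.+ c ℕ.+ b))} →
    toℕ u ≡ a → toℕ v ≡ a ℕ.+ c → u ≢ v → pathAdj (suc (a ℕ.+ c ℕ.+ b)) u v ≡ false →
    NoIsolated (pathAdj (suc (a ℕ.+ c ℕ.+ b))) →
    ∃ (IsKemeny (addEdge (pathAdj (suc (a ℕ.+ c ℕ.+ b))) u v))
  kemeny-cycle-exists a c b {u} {v} u≡a v≡a+c u≢v Auv nbr =
    kemeny-exists (addEdge-sym {A = P} (path-sym _) u v) (addEdge-noIsolated {A = P} nbr u v)
      (cycleGreen a c b u≡a v≡a+c u≢v Auv nbr) {{σ≢0}} {{V>0}}
    where
    P = pathAdj (suc (a ℕ.+ c ℕ.+ b))
    σ>0 : Positive ((ι 2 + ι 2 * ι c) * ι 2)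
    σ>0 = subst Positive (ι-⟦⟧ ((# 2 ⊕ # 2 ⊗ # c) ⊗ # 2)) (ι-pos ((2 ℕ.+ 2 ℕ.* c) ℕ.* 2))
    σ≢0 = subst (λ r → NonZero ((ι 2 + r) * ι 2)) (sym (resistance-path a c b u≡a v≡a+c u≢v Auv nbr))
            (pos⇒nonZero ((ι 2 + ι 2 * ι c) * ι 2) {{σ>0}})
    V>0 : Positive (volume (addEdge P u v))
    V>0 = subst Positive (sym (volume-cycle a c b u≡a v≡a+c u≢v Auv nbr))
      (subst Positive (ι-⟦⟧ (# 2 ⊗ (# a ⊕ # c ⊕ # b) ⊕ # 2))
        (ι-pos (2 ℕ.* (a ℕ.+ c ℕ.+ b) ℕ.+ 2) {{ℕ.>-nonZero (ℕₚ.<-≤-trans ℕ.z<s (ℕₚ.m≤n+m 2 (2 ℕ.* (a ℕ.+ c ℕ.+ b))))}}))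

-- Solving the quadratic inequality over the naturals.

module Threshold where

  open import Data.Nat
  open import Data.Nat.Properties
  open import Data.Nat.Tactic.RingSolver using (solve-∀)
  open import Function.Bundles using (_⇔_; mk⇔)
  open import Relation.Binary.PropositionalEquality
  open import Relation.Nullary using (yes; no; contradiction)
  open ≤-Reasoning

  open Comparison using (⟦_⟧ℕ; gain; loss)

  -- By contraposition. With f = c - 2 = l - 3 the bound 4c² + c - 2 becomes the subtraction-free 4
  -- (2 + f)² + f.
  balance⇒ : ∀ f a b → ⟦ loss a (1 + f) b ⟧ℕ < ⟦ gain a (1 + f) b ⟧ℕ →
    4 * ((2 + f) * (2 + f)) + f < 4 * (a + b)
  balance⇒ f a b lt with 4 * ((2 + f) * (2 + f)) + f <? 4 * (a + b)
  ... | yes p = p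
  ... | no ¬p = contradiction lt (≤⇒≯ (begin
    ⟦ gain a (1 + f) b ⟧ℕ
      ≤⟨ *-monoʳ-≤ (1 + f + 2) (*-cancelˡ-≤ 4 (bound (a + b) (≮⇒≥ ¬p))) ⟩
    (1 + f + 2) * (4 * ((1 + f + 1) * (1 + f + 1)) * (a + b) + (1 + f) * (1 + f) * (1 + f + 2))
      -- The a b term of `loss` is discarded here: two proper tails only make the new edge less
      -- favourable.
      ≤⟨ m≤m+n _ _ ⟩
    ⟦ loss a (1 + f) b ⟧ℕ ∎))
    where
    expand : ∀ s → 4 * (4 * (s * s)) ≡ 4 * s * (4 * s)
    expand = solve-∀
    split : ∀ f s → (4 * ((2 + f) * (2 + f)) + f) * (4 * s) ≡ 4 * (4 * ((2 + f) * (2 + f)) * s) + f * (4 * s)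
    split = solve-∀
    slack : ∀ f s →
      4 * (4 * ((2 + f) * (2 + f)) * s) + f * (4 * ((2 + f) * (2 + f)) + f) + (3 * (f * f) + 12 * f + 12)
      ≡ 4 * (4 * ((1 + f + 1) * (1 + f + 1)) * s + (1 + f) * (1 + f) * (1 + f + 2))
    slack = solve-∀
    bound : ∀ s → 4 * s ≤ 4 * ((2 + f) * (2 + f)) + f →
      4 * (4 * (s * s)) ≤ 4 * (4 * ((1 + f + 1) * (1 + f + 1)) * s + (1 + f) * (1 + f) * (1 + f + 2))
    bound s le = begin
      4 * (4 * (s * s))
        ≡⟨ expand s ⟩
      4 * s * (4 * s)
        -- The assumed bound is applied twice: now to one factor of (4s)², then to the 4s multiplied
        -- by f.
        ≤⟨ *-monoˡ-≤ (4 * s) le ⟩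
      (4 * ((2 + f) * (2 + f)) + f) * (4 * s)
        ≡⟨ split f s ⟩
      4 * (4 * ((2 + f) * (2 + f)) * s) + f * (4 * s)
        ≤⟨ +-monoʳ-≤ (4 * (4 * ((2 + f) * (2 + f)) * s)) (*-monoʳ-≤ f le) ⟩
      4 * (4 * ((2 + f) * (2 + f)) * s) + f * (4 * ((2 + f) * (2 + f)) + f)
        -- The added slack is 3c², the exact excess of 4 (c - 1)² l over f (4c² + f).
        ≤⟨ m≤m+n _ (3 * (f * f) + 12 * f + 12) ⟩
      4 * (4 * ((2 + f) * (2 + f)) * s) + f * (4 * ((2 + f) * (2 + f)) + f) + (3 * (f * f) + 12 * f + 12)
        ≡⟨ slack f s ⟩
      4 * (4 * ((1 + f + 1) * (1 + f + 1)) * s + (1 + f) * (1 + f) * (1 + f + 2)) ∎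

  -- Integrality gives 4s ≥ 4c² + f + 1, hence 4s² ≥ 4c² s + (c - 1) s. As s > c² - 1 = (c - 1) l,
  -- the last term exceeds (c - 1)² l.
  balance⇐ : ∀ f s → 4 * ((2 + f) * (2 + f)) + f < 4 * s →
    ⟦ loss s (1 + f) 0 ⟧ℕ < ⟦ gain s (1 + f) 0 ⟧ℕ
  balance⇐ f s lt = begin-strict
    ⟦ loss s (1 + f) 0 ⟧ℕ
      ≡⟨ simplify f s ⟩
    (3 + f) * (4 * ((2 + f) * (2 + f)) * s + (1 + f) * ((1 + f) * (3 + f)))
      <⟨ *-monoʳ-< (3 + f) (+-monoʳ-< (4 * ((2 + f) * (2 + f)) * s) (*-monoʳ-< (1 + f) large)) ⟩
    (3 + f) * (4 * ((2 + f) * (2 + f)) * s + (1 + f) * s)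
      ≡⟨ collect f s ⟩
    (3 + f) * (suc (4 * ((2 + f) * (2 + f)) + f) * s)
      ≤⟨ *-monoʳ-≤ (3 + f) (*-monoˡ-≤ s lt) ⟩
    (3 + f) * (4 * s * s)
      ≡⟨ finish f s ⟩
    ⟦ gain s (1 + f) 0 ⟧ℕ ∎
    where
    simplify : ∀ f s →
      (1 + f + 2) * (4 * ((1 + f + 1) * (1 + f + 1)) * (s + 0) + (1 + f) * (1 + f) * (1 + f + 2))
      + 12 * ((1 + f + 2 + (1 + f + 1) * (1 + f + 1)) * (s * 0))
      ≡ (3 + f) * (4 * ((2 + f) * (2 + f)) * s + (1 + f) * ((1 + f) * (3 + f)))
    simplify = solve-∀
    collect : ∀ f s → (3 + f) * (4 * ((2 + f) * (2 + f)) * s + (1 + f) * s)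
                      ≡ (3 + f) * ((1 + (4 * ((2 + f) * (2 + f)) + f)) * s)
    collect = solve-∀
    finish : ∀ f s → (3 + f) * (4 * s * s) ≡ (1 + f + 2) * (4 * ((s + 0) * (s + 0)))
    finish = solve-∀
    slack : ∀ f → 4 * ((1 + f) * (3 + f)) + (4 + f) ≡ 4 * ((2 + f) * (2 + f)) + f
    slack = solve-∀
    large : (1 + f) * (3 + f) < s
    large = *-cancelˡ-< 4 _ _ (begin-strict
      4 * ((1 + f) * (3 + f))              ≤⟨ m≤m+n _ (4 + f) ⟩
      4 * ((1 + f) * (3 + f)) + (4 + f)    ≡⟨ slack f ⟩
      4 * ((2 + f) * (2 + f)) + f          <⟨ lt ⟩
      4 * s                                ∎)

  -- Cancelling 28 f + 84 turns the right inequality into 4X + 3 < 4 (4s). As 4X and 16s are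
  -- multiples of 4, the remainder 3 is absorbed.
  integral⇔ : ∀ f s → 4 * ((2 + f) * (2 + f)) + f < 4 * s ⇔
    16 * ((3 + f) * (3 + f)) + 7 < 16 * (s + (3 + f)) + 12 * (3 + f)
  integral⇔ f s = mk⇔ to from
    where
    X = 4 * ((2 + f) * (2 + f)) + f
    lhs : ∀ f → 16 * ((3 + f) * (3 + f)) + 7 ≡ 4 * (4 * ((2 + f) * (2 + f)) + f) + 3 + (28 * f + 84)
    lhs = solve-∀
    rhs : ∀ f s → 16 * (s + (3 + f)) + 12 * (3 + f) ≡ 4 * (4 * s) + (28 * f + 84)
    rhs = solve-∀
    next : ∀ x → suc (4 * x + 3) ≡ 4 * suc x
    next = solve-∀
    to : X < 4 * s → 16 * ((3 + f) * (3 + f)) + 7 < 16 * (s + (3 + f)) + 12 * (3 + f)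
    to lt = subst₂ _<_ (sym (lhs f)) (sym (rhs f s)) (+-monoˡ-< (28 * f + 84)
      (≤-trans (≤-reflexive (next X)) (*-monoʳ-≤ 4 lt)))
    from : 16 * ((3 + f) * (3 + f)) + 7 < 16 * (s + (3 + f)) + 12 * (3 + f) → X < 4 * s
    from lt = *-cancelˡ-< 4 X (4 * s) (≤-<-trans (m≤m+n (4 * X) 3)
      (+-cancelʳ-< (28 * f + 84) (4 * X + 3) (4 * (4 * s)) (subst₂ _<_ (lhs f) (rhs f s) lt)))

  -- If k < l, the right side is at most 28 l, which is below 16 l² once l ≥ 3. Hence a cycle of
  -- length l fits into the path.
  threshold⇒l≤k : ∀ f k → 16 * ((3 + f) * (3 + f)) + 7 < 16 * k + 12 * (3 + f) → 3 + f ≤ k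
  threshold⇒l≤k f k lt with 3 + f ≤? k
  ... | yes p = p
  ... | no ¬p = contradiction lt (≤⇒≯ (begin
    16 * k + 12 * (3 + f)
      ≤⟨ +-monoˡ-≤ (12 * (3 + f)) (*-monoʳ-≤ 16 (<⇒≤ (≰⇒> ¬p))) ⟩
    16 * (3 + f) + 12 * (3 + f)
      ≤⟨ m≤m+n _ (67 + 68 * f + 16 * (f * f)) ⟩
    16 * (3 + f) + 12 * (3 + f) + (67 + 68 * f + 16 * (f * f))
      ≡⟨ slack f ⟩
    16 * ((3 + f) * (3 + f)) + 7 ∎))
    where
    slack : ∀ f → 16 * (3 + f) + 12 * (3 + f) + (67 + 68 * f + 16 * (f * f)) ≡ 16 * ((3 + f) * (3 + f)) + 7
    slack = solve-∀

-- Braess edges of the path in both directions.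

module BraessPath where

  open import Data.Bool using (false; _∨_)
  open import Data.Fin using (Fin; toℕ; fromℕ<)
  open import Data.Fin.Properties using (toℕ-fromℕ<)
  open import Data.Nat
  open import Data.Nat.Properties
  open import Data.Nat.Tactic.RingSolver using (solve-∀)
  open import Data.Product using (_×_; ∃₂; _,_; proj₁; proj₂)
  open import Function.Bundles using (Equivalence)
  open import Relation.Binary.PropositionalEquality hiding (trans)
  import Relation.Binary.PropositionalEquality as ≡
  open import Relation.Nullary.Decidable using (dec-false)

  open Kemeny using (NoIsolated)
  open Path using (path-noIsolated)
  open Comparison
  open Threshold

  order-split : ∀ a f b → suc (a + (2 + f) + b) ≡ a + b + (3 + f)
  order-split = solve-∀

  order≢0 : ∀ a f b → 0 < a + (2 + f) + b
  order≢0 a f b = ≤-trans (≤-trans z<s (m≤n+m (2 + f) a)) (m≤m+n (a + (2 + f)) b)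

  noIsolated : ∀ {n} → 0 < n → NoIsolated (pathAdj (suc n))
  noIsolated {suc n} _ = path-noIsolated n

  -- The order `k` is a variable with an equation, so that matching on `refl` rewrites the type
  -- `Fin k` of the given vertices instead of transporting them.
  braess⇒threshold : ∀ a f b {k} {i j : Fin k} → k ≡ suc (a + (2 + f) + b) → toℕ i ≡ a → toℕ j ≡ a + (2 + f) →
    IsBraess (pathAdj k) i j → 16 * ((3 + f) * (3 + f)) + 7 < 16 * k + 12 * (3 + f)
  braess⇒threshold a f b refl i≡a j≡a+c (i≢j , Aij , κ , κ′ , κ-path , κ′-cycle , κ<κ′) =
    subst (λ k → 16 * ((3 + f) * (3 + f)) + 7 < 16 * k + 12 * (3 + f)) (sym (order-split a f b))
      (Equivalence.to (integral⇔ f (a + b)) (balance⇒ f a b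
        (Equivalence.to (kemeny-comparison a (1 + f) b i≡a j≡a+c i≢j Aij
          (noIsolated (order≢0 a f b)) κ-path κ′-cycle) κ<κ′)))

  -- The witness places the cycle at the far end of the path, with a single tail of `s` edges; this
  -- is the most favourable position, a b = 0.
  threshold⇒braess : ∀ s f {k} → k ≡ suc (s + (2 + f) + 0) → 16 * ((3 + f) * (3 + f)) + 7 < 16 * k + 12 * (3 + f) →
    ∃₂ λ (i j : Fin k) → toℕ i < toℕ j × (toℕ j ∸ toℕ i) + 1 ≡ 3 + f × IsBraess (pathAdj k) i j
  threshold⇒braess s f refl lt =
    i , j , i<j , length , i≢j , Aij , κ , κ′ , κ-path , κ′-cycle ,
    Equivalence.from (kemeny-comparison s (1 + f) 0 i≡s j≡s+c i≢j Aij nbr κ-path κ′-cycle)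
      (balance⇐ f s (Equivalence.from (integral⇔ f s)
        (subst (λ k → 16 * ((3 + f) * (3 + f)) + 7 < 16 * k + 12 * (3 + f)) order lt)))
    where
    n = s + (2 + f) + 0

    s<s+c : s < s + (2 + f)
    s<s+c = m<m+n s z<s

    s+c<k : s + (2 + f) < suc n
    s+c<k = s≤s (m≤m+n (s + (2 + f)) 0)

    s<k : s < suc n
    s<k = <-trans s<s+c s+c<k

    i j : Fin (suc n)
    i = fromℕ< s<k
    j = fromℕ< s+c<k

    i≡s : toℕ i ≡ s
    i≡s = toℕ-fromℕ< s<k

    j≡s+c : toℕ j ≡ s + (2 + f)
    j≡s+c = toℕ-fromℕ< s+c<k

    i<j : toℕ i < toℕ j
    i<j = subst₂ _<_ (sym i≡s) (sym j≡s+c) s<s+c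

    i≢j : i ≢ j
    i≢j i≡j = <⇒≢ i<j (cong toℕ i≡j)

    length : (toℕ j ∸ toℕ i) + 1 ≡ 3 + f
    length = ≡.trans (cong₂ (λ y x → (y ∸ x) + 1) j≡s+c i≡s)
      (≡.trans (cong (_+ 1) (m+n∸m≡n s (2 + f))) (+-comm (2 + f) 1))

    -- The ends lie 2 + f ≥ 2 apart, so the chord is not an edge of the path; this uses l ≥ 3.
    Aij : pathAdj (suc n) i j ≡ false
    Aij = ≡.trans (cong₂ (λ x y → ((x + 1) ≡ᵇ y) ∨ ((y + 1) ≡ᵇ x)) i≡s j≡s+c)
      (cong₂ _∨_
        (dec-false (s + 1 ≟ s + (2 + f)) (λ eq → 0≢1+n (suc-injective (+-cancelˡ-≡ s 1 (2 + f) eq))))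
        (dec-false (s + (2 + f) + 1 ≟ s) (λ eq → <⇒≢ (<-≤-trans s<s+c (m≤m+n (s + (2 + f)) 1)) (sym eq))))

    nbr : NoIsolated (pathAdj (suc n))
    nbr = noIsolated (order≢0 s f 0)

    order : suc n ≡ s + (3 + f)
    order = ≡.trans (order-split s f 0) (cong (_+ (3 + f)) (+-identityʳ s))

    path  = kemeny-path-exists n {{>-nonZero (order≢0 s f 0)}} nbr
    cycle = kemeny-cycle-exists s (2 + f) 0 i≡s j≡s+c i≢j Aij nbr
    κ  = proj₁ path
    κ′ = proj₁ cycle
    κ-path   = proj₂ path
    κ′-cycle = proj₂ cycle

open import Data.Nat using (ℕ; suc; s≤s; _≤_; _∸_; _+_; _*_)
open import Data.Nat.Properties using (m+[n∸m]≡n; m∸n+n≡m; <⇒≤; +-cancelʳ-≡; +-comm; +-identityʳ)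
open import Data.Fin using (Fin; toℕ)
open import Data.Fin.Properties using (toℕ<n)
open import Data.Integer using (+_)
open import Data.Rational as ℚ using (ℚ)
open import Data.Product using (_×_; ∃₂; _,_)
open import Function.Bundles using (_⇔_; mk⇔; Equivalence)
open import Relation.Binary.PropositionalEquality using (_≡_; cong; sym)
import Relation.Binary.PropositionalEquality as ≡

theorem3p4 : (k l : ℕ) → 3 ≤ k → 3 ≤ l →
    (∃₂ λ (i j : Fin k) →
    Data.Nat._<_ (toℕ i) (toℕ j) × (toℕ j ∸ toℕ i) + 1 ≡ l × IsBraess (pathAdj k) i j)
    ⇔ ((ℕtoℚ (l * l) ℚ.- (+ 3 ℚ./ 4) ℚ.* ℕtoℚ l ℚ.+ (+ 7 ℚ./ 16)) ℚ.< ℕtoℚ k)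
theorem3p4 k l@(suc (suc (suc f))) _ (s≤s (s≤s (s≤s _))) = mk⇔
  (λ (i , j , i<j , length , braess) →
    let j∸i≡2+f = +-cancelʳ-≡ 1 (toℕ j ∸ toℕ i) (2 + f) (≡.trans length (+-comm 1 (2 + f)))
        j≡i+2+f = ≡.trans (sym (m+[n∸m]≡n (<⇒≤ i<j))) (cong (λ t → toℕ i + t) j∸i≡2+f)
        -- The k - (j + 1) vertices after `j` give the number b of edges in the second tail.
        k≡      = ≡.trans (sym (m+[n∸m]≡n (toℕ<n j))) (cong (λ t → suc t + (k ∸ suc (toℕ j))) j≡i+2+f)
    in Equivalence.from (Comparison.threshold⇔ k l)
         (BraessPath.braess⇒threshold (toℕ i) f (k ∸ suc (toℕ j)) k≡ ≡.refl j≡i+2+f braess))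
  (λ above →
    let lt  = Equivalence.to (Comparison.threshold⇔ k l) above
        -- All edges outside the cycle go into one tail; `threshold⇒l≤k` ensures that the
        -- subtraction is not truncated.
        s   = k ∸ l
        k≡  = ≡.trans (sym (m∸n+n≡m (Threshold.threshold⇒l≤k f k lt)))
                (≡.trans (cong (λ t → t + l) (sym (+-identityʳ s))) (sym (BraessPath.order-split s f 0)))
    in BraessPath.threshold⇒braess s f k≡ lt)
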